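{- Let $G$ be an infinite ordered group and $T = \mathrm{Th}(G; +, <)$. Then $T$ is dp-small if and only if $G$ is abelian and divisible.
   Context: For a complete theory $T$ in language $L$ with monster model $\mathcal{U}$ ($\mathcal{U}_y$ the $|y|$-tuples from $\mathcal{U}$): a partial type $\pi(x)$ is dp-small if there do not exist $L(\mathcal{U})$-formulas $\varphi_i(x)$ ($i<\omega$), an $L$-formula $\psi(x;y)$ and $b_j\in\mathcal{U}_y$ ($j<\omega$) such that for all $i_0,j_0<\omega$ the type $\pi(x)\cup\{\varphi_{i_0}(x),\psi(x;b_{j_0})\}\cup\{\neg\varphi_i(x): i\ne i_0\}\cup\{\neg\psi(x;b_j): j\neq j_0\}$ is consistent. $T$ is dp-small if $x=x$ is dp-small for $x$ a single variable. -}

module Defs where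

open import Level using (Level; _⊔_) renaming (suc to lsuc)
open import Algebra.Bundles using (Group)
import Algebra.Definitions.RawMonoid as RawMonoidDefs
open import Algebra.Definitions using (Commutative)
open import Data.Empty.Polymorphic using (⊥)
open import Data.Fin.Base using (Fin; zero)
open import Data.List.Base using (List)
open import Data.List.Relation.Unary.All using (All)
open import Data.Nat.Base using (ℕ; suc; _+_; NonZero)
open import Data.Product.Base using (Σ; ∃-syntax; _×_)
open import Data.Vec.Base using (Vec; []; _∷_; _++_; lookup; map)
open import Data.Vec.Relation.Binary.Pointwise.Inductive
  using (Pointwise; []; _∷_)
open import Function.Bundles using (Bijection; _↣_; _⇔_)
open import Relation.Binary.Bundles using (Setoid)
open import Relation.Binary.Core using (Rel)
open import Relation.Binary.PropositionalEquality.Core using (_≡_; _≢_)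
open import Relation.Binary.PropositionalEquality.Properties using (setoid)
open import Relation.Binary.Structures using (IsStrictTotalOrder)
open import Relation.Nullary.Negation.Core using (¬_)
open import Relation.Unary using (Pred; _∈_; _∪_; ｛_｝)

record Language : Set₁ where
  field
    Func  : ℕ → Set
    Relat : ℕ → Set

data Term (L : Language) (n : ℕ) : Set where
  var  : Fin n → Term L n
  func : ∀ {k} → Language.Func L k → Vec (Term L n) k → Term L n

-- The remaining connectives and ∃ are the usual classical abbreviations.
-- Variables are de Bruijn indices; `all` binds variable zero.
infix  7 _≐_
infixr 6 _⇒_
data Formula (L : Language) (n : ℕ) : Set where
  _≐_ : Term L n → Term L n → Formula L n
  rel : ∀ {k} → Language.Relat L k → Vec (Term L n) k → Formula L n
  bot : Formula L n
  _⇒_ : Formula L n → Formula L n → Formula L n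
  all : Formula L (suc n) → Formula L n

neg : ∀ {L : Language} {n : ℕ} → Formula L n → Formula L n
neg φ = φ ⇒ bot

Sentence : Language → Set
Sentence L = Formula L 0

-- Equality of a structure is the equality of its carrier setoid.
record Structure (L : Language) (ℓ : Level) : Set (lsuc ℓ) where
  open Language L
  field
    carrierSetoid : Setoid ℓ ℓ
  open Setoid carrierSetoid public using (Carrier; _≈_)
  field
    funI     : ∀ {k} → Func k → Vec Carrier k → Carrier
    funI-cong : ∀ {k} (f : Func k) {xs ys : Vec Carrier k} →
                Pointwise _≈_ xs ys → funI f xs ≈ funI f ys
    relI     : ∀ {k} → Relat k → Vec Carrier k → Set ℓ
    relI-resp : ∀ {k} (R : Relat k) {xs ys : Vec Carrier k} →
                Pointwise _≈_ xs ys → relI R xs → relI R ys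

module Semantics {L : Language} {ℓ : Level} (M : Structure L ℓ) where
  open Structure M

  mutual
    eval : ∀ {n} → Term L n → Vec Carrier n → Carrier
    eval (var i)     ρ = lookup ρ i
    eval (func f ts) ρ = funI f (evals ts ρ)

    evals : ∀ {n k} → Vec (Term L n) k → Vec Carrier n → Vec Carrier k
    evals []       ρ = []
    evals (t ∷ ts) ρ = eval t ρ ∷ evals ts ρ

  Sat : ∀ {n} → Formula L n → Vec Carrier n → Set ℓ
  Sat (s ≐ t)    ρ = eval s ρ ≈ eval t ρ
  Sat (rel R ts) ρ = relI R (evals ts ρ)
  Sat bot        ρ = ⊥
  Sat (φ ⇒ χ)    ρ = Sat φ ρ → Sat χ ρ
  Sat (all φ)    ρ = ∀ x → Sat φ (x ∷ ρ)

open Semantics public using (Sat)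

Theory : Language → (ℓ : Level) → Set (lsuc ℓ)
Theory L ℓ = Pred (Sentence L) ℓ

Th : ∀ {L : Language} {ℓ : Level} → Structure L ℓ → Theory L ℓ
Th M φ = Sat M φ []

-- An L(A)-formula in n free variables: an L-formula φ(x;z) together with a
-- tuple from A substituted for z.
record PFormula (L : Language) {a : Level} (A : Set a) (n : ℕ) : Set a where
  constructor _⟨_⟩
  field
    {arity} : ℕ
    formula : Formula L (n + arity)
    params  : Vec A arity

pneg : ∀ {L : Language} {a : Level} {A : Set a} {n : ℕ} →
       PFormula L A n → PFormula L A n
pneg (φ ⟨ c ⟩) = neg φ ⟨ c ⟩

PartialType : Language → {a : Level} → Set a → ℕ → Set (lsuc a)
PartialType L {a} A n = Pred (PFormula L A n) a

module _ {L : Language} {ℓ : Level} (M : Structure L ℓ) where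
  open Structure M using (Carrier; _≈_; funI; relI; carrierSetoid)

  -- Parameters are elements of M named by the family e; for formulas over M
  -- itself, e is the identity.
  PSat : ∀ {a : Level} {A : Set a} (e : A → Carrier) {n : ℕ} →
         PFormula L A n → Vec Carrier n → Set ℓ
  PSat e (φ ⟨ c ⟩) x = Sat M φ (x ++ map e c)

  -- Consistency with the elementary diagram of M, i.e. finite satisfiability
  -- in M.
  Consistent : ∀ {a : Level} {A : Set a} (e : A → Carrier) {n : ℕ} →
               PartialType L A n → Set (a ⊔ ℓ)
  Consistent e {n} p =
    (Φ : List (PFormula L _ n)) → All (_∈ p) Φ →
    ∃[ x ] All (λ φ → PSat e φ x) Φ

  Realized : ∀ {a : Level} {A : Set a} (e : A → Carrier) {n : ℕ} →
             PartialType L A n → Set (a ⊔ ℓ)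
  Realized e p = ∃[ x ] (∀ φ → φ ∈ p → PSat e φ x)

  PartialElementary : ∀ {a : Level} {A : Set a} (e e′ : A → Carrier) →
                      Set (a ⊔ ℓ)
  PartialElementary {A = A} e e′ =
    ∀ {m} (φ : Formula L m) (t : Vec A m) →
    Sat M φ (map e t) ⇔ Sat M φ (map e′ t)

  record Automorphism : Set ℓ where
    field
      bijection : Bijection carrierSetoid carrierSetoid
    open Bijection bijection public using (to)
    field
      fun-hom : ∀ {k} (f : Language.Func L k) (xs : Vec Carrier k) →
                to (funI f xs) ≈ funI f (map to xs)
      rel-iso : ∀ {k} (R : Language.Relat L k) (xs : Vec Carrier k) →
                relI R xs ⇔ relI R (map to xs)

-- |A| < |κ|, using comparability of cardinals (classical).
Small : ∀ {k : Level} (κ A : Set k) → Set k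
Small κ A = ¬ (κ ↣ A)

-- A κ-saturated, strongly κ-homogeneous model of T, where κ > |L| (= the
-- number of L-sentences).  The cardinal κ is represented by a type, and small
-- subsets of the model by families indexed by small types.
record MonsterModel {L : Language} {t : Level} (T : Theory L t)
                    {k : Level} (κ : Set k) (u : Level)
                    : Set (t ⊔ lsuc k ⊔ lsuc u) where
  field
    structure : Structure L u
  open Structure structure public using (Carrier; _≈_)
  field
    models      : ∀ φ → φ ∈ T → Sat structure φ []
    large       : ¬ (κ ↣ Sentence L)
    saturated   : ∀ {A : Set k} → Small κ A → (e : A → Carrier) →
                  (p : PartialType L A 1) →
                  Consistent structure e p → Realized structure e p
    homogeneous : ∀ {A : Set k} → Small κ A → (e e′ : A → Carrier) →
                  PartialElementary structure e e′ →
                  Σ (Automorphism structure) λ σ →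
                    ∀ i → Automorphism.to σ (e i) ≈ e′ i

module _ {L : Language} {t : Level} {T : Theory L t}
         {k : Level} {κ : Set k} {u : Level} (𝓤 : MonsterModel T κ u) where
  open MonsterModel 𝓤 using (structure; Carrier)

  dpType : ∀ {n m : ℕ} → PartialType L Carrier n →
           (φ : ℕ → PFormula L Carrier n) →
           (ψ : Formula L (n + m)) (b : ℕ → Vec Carrier m) →
           (i₀ j₀ : ℕ) → PartialType L Carrier n
  dpType π φ ψ b i₀ j₀ =
      π
    ∪ ｛ φ i₀ ｝ ∪ ｛ ψ ⟨ b j₀ ⟩ ｝
    ∪ (λ χ → ∃[ i ] (i ≢ i₀ × χ ≡ pneg (φ i)))
    ∪ (λ χ → ∃[ j ] (j ≢ j₀ × χ ≡ pneg (ψ ⟨ b j ⟩)))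

  DpSmallType : ∀ {n : ℕ} → PartialType L Carrier n → Set u
  DpSmallType {n} π =
    ¬ (Σ (ℕ → PFormula L Carrier n) λ φ →
       Σ ℕ λ m →
       Σ (Formula L (n + m)) λ ψ →
       Σ (ℕ → Vec Carrier m) λ b →
       ∀ i₀ j₀ → Consistent structure (λ c → c) (dpType π φ ψ b i₀ j₀))

  DpSmall : Set u
  DpSmall = DpSmallType {1} ｛ (var zero ≐ var zero) ⟨ [] ⟩ ｝

-- Not assumed abelian; the order is linear and invariant under translation on
-- both sides.
record OrderedGroup (ℓ : Level) : Set (lsuc ℓ) where
  field
    group : Group ℓ ℓ
  open Group group public
    using (Carrier; _≈_; rawMonoid) renaming (_∙_ to _⊕_; ∙-cong to ⊕-cong)
  infix 4 _<_
  field
    _<_                : Rel Carrier ℓ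
    isStrictTotalOrder : IsStrictTotalOrder _≈_ _<_
    <-translateˡ       : ∀ z {x y} → x < y → (z ⊕ x) < (z ⊕ y)
    <-translateʳ       : ∀ z {x y} → x < y → (x ⊕ z) < (y ⊕ z)

data PlusSym : ℕ → Set where
  plus : PlusSym 2

data LessSym : ℕ → Set where
  less : LessSym 2

L⟨+,<⟩ : Language
L⟨+,<⟩ = record { Func = PlusSym ; Relat = LessSym }

module _ {ℓ : Level} (G : OrderedGroup ℓ) where
  open OrderedGroup G

  Infinite : Set ℓ
  Infinite = ¬ (∃[ n ] Bijection (setoid (Fin n)) (Group.setoid group))

  Abelian : Set ℓ
  Abelian = Commutative _≈_ _⊕_

  Divisible : Set ℓ
  Divisible = ∀ (n : ℕ) .{{_ : NonZero n}} (x : Carrier) →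
              ∃[ y ] (RawMonoidDefs._×_ rawMonoid n y ≈ x)

  asStructure : Structure L⟨+,<⟩ ℓ
  asStructure = record
    { carrierSetoid = Group.setoid group
    ; funI          = λ { plus (x ∷ y ∷ []) → x ⊕ y }
    ; funI-cong     = λ { plus (p ∷ q ∷ []) → ⊕-cong p q }
    ; relI          = λ { less (x ∷ y ∷ []) → x < y }
    ; relI-resp     = λ { less (p ∷ q ∷ []) x<y →
        IsStrictTotalOrder.<-respˡ-≈ isStrictTotalOrder p
          (IsStrictTotalOrder.<-respʳ-≈ isStrictTotalOrder q x<y) }
    }

{-# OPTIONS --safe #-}
module Submission where

-- Everything happens in the monster model 𝓤, which is again an ordered group.
--
-- If x and y do not commute, then by uniqueness of roots no nonzero multiple of x commutes with y,
-- nor conversely, so the cosets i y + C(x) are pairwise disjoint, as are the cosets C(y) + j x;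
-- they meet in i y + j x.  If 𝓤 is abelian and h > 0 is not divisible by m, saturation gives an
-- element w above all multiples of h and divisible by all powers of m; then the sets
-- mⁱ𝓤 \ mⁱ⁺¹𝓤 and the intervals (j w , (j + 1) w) meet in j w + mⁱ h.
--
-- Conversely, if 𝓤 is divisible abelian, quantifier elimination bounds by some K, uniformly in b,
-- the number of points that determine the truth of ψ(x; b).  Given a pattern with K + 1 rows and
-- enough columns, the pigeonhole principle yields columns j₁ ≠ j₂ that meet each row in a single
-- cell of the decomposition of the line induced by φ₀, …, φ_K; so ψ(x; b_j₁) changes its truth
-- value inside K + 1 disjoint cells.

open import Defs
open import Level using (Level; Lift; lift; lower)
open import Algebra.Bundles using (Group; CommutativeMonoid)
open import Algebra.Structures using (IsGroup)
open import Axiom.ExcludedMiddle using (ExcludedMiddle)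
open import Data.Empty as Empty using (⊥-elim)
open import Data.Empty.Polymorphic using (⊥)
open import Data.Fin.Base using (Fin; zero; suc; toℕ; funToFin; finToFun; opposite)
open import Data.Fin.Properties as Fin using (_≟_)
open import Data.List.Base as List using (List; []; _∷_; map; filter)
open import Data.List.Membership.Propositional using (find; lose) renaming (_∈_ to _∈ᴸ_)
open import Data.List.Membership.Propositional.Properties
  using (∈-map⁺; ∈-filter⁺; ∈-filter⁻; ∈-cartesianProductWith⁺; ∈-concat⁺′; ∈-applyUpTo⁺)
open import Data.List.Relation.Unary.All as All using (All; []; _∷_)
import Data.List.Relation.Unary.All.Properties as All
open import Data.List.Relation.Unary.Any as Any using (Any)
import Data.List.Relation.Unary.Any.Properties as Any
open import Data.Nat.Base as ℕ using (ℕ; zero; suc; z<s; s<s; s≤s)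
import Data.Nat.Properties as ℕ
open import Data.Product.Base using (_×_; _,_; proj₁; proj₂; ∃-syntax)
open import Data.Sum.Base using (inj₁; inj₂)
open import Data.Unit.Base using (⊤)
open import Data.Vec.Base as Vec using (Vec; []; _∷_; lookup)
open import Data.Vec.Relation.Binary.Pointwise.Inductive using ([]; _∷_)
open import Function.Base using (_∘_)
open import Function.Bundles using (_⇔_; mk⇔; Injection)
open import Relation.Binary.Bundles using (module Setoid)
open import Relation.Binary.Definitions using (tri<; tri≈; tri>; Trichotomous)
open import Relation.Binary.PropositionalEquality as ≡ using (_≡_; _≢_)
open import Relation.Binary.Structures using (IsStrictTotalOrder)
open import Relation.Nullary using (Dec; ¬_; yes; no; contradiction)
open import Relation.Nullary.Decidable using (decidable-stable)
open import Relation.Unary using (_∈_; ｛_｝)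

private variable
  ℓ ℓ′ : Level
  n    : ℕ

-- Formulas and structures for ordered groups.

pattern #0 = zero
pattern #1 = suc zero
pattern #2 = suc (suc zero)

infixl 8 _⊞_
_⊞_ : Term L⟨+,<⟩ n → Term L⟨+,<⟩ n → Term L⟨+,<⟩ n
s ⊞ t = func plus (s ∷ t ∷ [])

infix 7 _≺_
_≺_ : Term L⟨+,<⟩ n → Term L⟨+,<⟩ n → Formula L⟨+,<⟩ n
s ≺ t = rel less (s ∷ t ∷ [])

ex : ∀ {L} → Formula L (suc n) → Formula L n
ex φ = neg (all (neg φ))

infixr 6 _∧_
_∧_ : ∀ {L} → Formula L n → Formula L n → Formula L n
φ ∧ χ = neg (φ ⇒ neg χ)

-- suc k copies of t, as the language has no symbol for 0
multiple : ℕ → Term L⟨+,<⟩ n → Term L⟨+,<⟩ n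
multiple zero t = t
multiple (suc k) t = t ⊞ multiple k t

-- The language names neither zero nor negatives, so both are data here. An arbitrary structure is
-- allowed, so that the notion applies to `G` and to the monster model alike.
record IsOrderedGroup (M : Structure L⟨+,<⟩ ℓ) : Set ℓ where
  open Structure M
  infixl 6 _⊕_
  infix 4 _<_
  infix 8 ⊖_

  _⊕_ : Carrier → Carrier → Carrier
  x ⊕ y = funI plus (x ∷ y ∷ [])

  _<_ : Carrier → Carrier → Set _
  x < y = relI less (x ∷ y ∷ [])

  field
    ε                  : Carrier
    ⊖_                 : Carrier → Carrier
    isGroup            : IsGroup _≈_ _⊕_ ε ⊖_
    isStrictTotalOrder : IsStrictTotalOrder _≈_ _<_
    <-translateˡ       : ∀ z {x y} → x < y → z ⊕ x < z ⊕ y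
    <-translateʳ       : ∀ z {x y} → x < y → x ⊕ z < y ⊕ z

asStructure-isOrderedGroup : (G : OrderedGroup ℓ) → IsOrderedGroup (asStructure G)
asStructure-isOrderedGroup G = record
  { ε = Group.ε group
  ; ⊖_ = Group._⁻¹ group
  ; isGroup = Group.isGroup group
  ; isStrictTotalOrder = isStrictTotalOrder
  ; <-translateˡ = <-translateˡ
  ; <-translateʳ = <-translateʳ
  }
  where
  open OrderedGroup G

-- Multiples, roots and centralizers in an ordered group.

module OrderedGroupProperties {M : Structure L⟨+,<⟩ ℓ} (isOG : IsOrderedGroup M) where

  open Structure M using (Carrier; _≈_; relI-resp)
  open IsOrderedGroup isOG public
  open IsStrictTotalOrder isStrictTotalOrder public
    using (compare; <-respˡ-≈; <-respʳ-≈) renaming (trans to <-trans; irrefl to <-irrefl)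

  group : Group ℓ ℓ
  group = record { isGroup = isGroup }

  open Group group public
    using (setoid; monoid; refl; sym; trans; identityˡ; identityʳ; inverseˡ; inverseʳ; assoc; _\\_; _//_)
    renaming (∙-cong to ⊕-cong; ∙-congˡ to ⊕-congˡ; ∙-congʳ to ⊕-congʳ; ⁻¹-cong to ⊖-cong)
  open import Algebra.Properties.Group group public
    using ( \\-leftDividesˡ; \\-leftDividesʳ; //-rightDividesˡ; //-rightDividesʳ
          ; inverseʳ-unique; ⁻¹-involutive; ∙-cancelˡ; ∙-cancelʳ)
  open import Algebra.Properties.Monoid.Mult monoid public
    using (×-congʳ; ×-congˡ; ×-homo-+; ×-assocˡ) renaming (_×_ to _·_)
  open import Relation.Binary.Reasoning.Setoid setoid

  ⊕-cancelˡ : ∀ x {y z} → x ⊕ y ≈ x ⊕ z → y ≈ z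
  ⊕-cancelˡ x = ∙-cancelˡ x _ _

  ⊕-cancelʳ : ∀ x {y z} → y ⊕ x ≈ z ⊕ x → y ≈ z
  ⊕-cancelʳ x = ∙-cancelʳ x _ _

  <-asym : ∀ {x y} → x < y → ¬ (y < x)
  <-asym x<y y<x = <-irrefl refl (<-trans x<y y<x)

  ⊕-mono-< : ∀ {x y z w} → x < y → z < w → x ⊕ z < y ⊕ w
  ⊕-mono-< x<y z<w = <-trans (<-translateʳ _ x<y) (<-translateˡ _ z<w)

  x<x⊕y : ∀ x {y} → ε < y → x < x ⊕ y
  x<x⊕y x ε<y = <-respˡ-≈ (identityʳ x) (<-translateˡ x ε<y)

  ·-mono-< : ∀ k {x y} → x < y → suc k · x < suc k · y
  ·-mono-< zero x<y = <-translateʳ ε x<y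
  ·-mono-< (suc k) x<y = ⊕-mono-< x<y (·-mono-< k x<y)

  -- Uniqueness of roots: two-sided invariance makes multiplication by `suc k` strictly monotone,
  -- and trichotomy does the rest.
  ·-injective : ∀ k {x y} → suc k · x ≈ suc k · y → x ≈ y
  ·-injective k {x} {y} kx≈ky with compare x y
  ... | tri< x<y _ _ = contradiction (·-mono-< k x<y) (<-irrefl kx≈ky)
  ... | tri≈ _ x≈y _ = x≈y
  ... | tri> _ _ y<x = contradiction (·-mono-< k y<x) (<-irrefl (sym kx≈ky))

  ·-ε : ∀ k → k · ε ≈ ε
  ·-ε zero = refl
  ·-ε (suc k) = trans (identityˡ _) (·-ε k)

  ·-positive : ∀ k {x} → ε < x → ε < suc k · x
  ·-positive k ε<x = <-respˡ-≈ (·-ε (suc k)) (·-mono-< k ε<x)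

  ·-monoˡ-< : ∀ {k l x} → ε < x → k ℕ.< l → k · x < l · x
  ·-monoˡ-< ε<x (z<s {l}) = ·-positive l ε<x
  ·-monoˡ-< {x = x} ε<x (s<s k<l@(s≤s _)) = <-translateˡ x (·-monoˡ-< ε<x k<l)

  eval-multiple : ∀ k (t : Term L⟨+,<⟩ n) ρ →
    Semantics.eval M (multiple k t) ρ ≈ suc k · Semantics.eval M t ρ
  eval-multiple zero t ρ = sym (identityʳ _)
  eval-multiple (suc k) t ρ = ⊕-congˡ (eval-multiple k t ρ)

  Commutes : Carrier → Carrier → Set ℓ
  Commutes x y = x ⊕ y ≈ y ⊕ x

  -- The hypothesis makes `x′` the conjugate y + x - y, and conjugation is additive. With `x′ = x`
  -- it shows that multiples of `x` commute with `y`.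
  conjugate-multiple : ∀ {x x′ y} → x′ ⊕ y ≈ y ⊕ x → ∀ k → k · x′ ⊕ y ≈ y ⊕ k · x
  conjugate-multiple eq zero = trans (identityˡ _) (sym (identityʳ _))
  conjugate-multiple {x} {x′} {y} eq (suc k) = begin
    (x′ ⊕ k · x′) ⊕ y  ≈⟨ assoc _ _ _ ⟩
    x′ ⊕ (k · x′ ⊕ y)  ≈⟨ ⊕-congˡ (conjugate-multiple eq k) ⟩
    x′ ⊕ (y ⊕ k · x)   ≈⟨ assoc _ _ _ ⟨
    (x′ ⊕ y) ⊕ k · x   ≈⟨ ⊕-congʳ eq ⟩
    (y ⊕ x) ⊕ k · x    ≈⟨ assoc _ _ _ ⟩
    y ⊕ (x ⊕ k · x)    ∎

  -- x and its conjugate y + x − y have the same multiple, hence agree by uniqueness of roots.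
  commutes-root : ∀ {x y} k → Commutes (suc k · x) y → Commutes x y
  commutes-root {x} {y} k comm = trans (⊕-congʳ x≈x′) conj
    where
    conj : ((y ⊕ x) // y) ⊕ y ≈ y ⊕ x
    conj = //-rightDividesˡ y (y ⊕ x)

    x≈x′ : x ≈ (y ⊕ x) // y
    x≈x′ = ·-injective k (⊕-cancelʳ y (trans comm (sym (conjugate-multiple conj (suc k)))))

  commutes-cancelʳ : ∀ {x y z} → Commutes y x → Commutes (z ⊕ y) x → Commutes z x
  commutes-cancelʳ {x} {y} {z} yx zyx = ⊕-cancelʳ y (begin
    (z ⊕ x) ⊕ y  ≈⟨ assoc _ _ _ ⟩
    z ⊕ (x ⊕ y)  ≈⟨ ⊕-congˡ yx ⟨
    z ⊕ (y ⊕ x)  ≈⟨ assoc _ _ _ ⟨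
    (z ⊕ y) ⊕ x  ≈⟨ zyx ⟩
    x ⊕ (z ⊕ y)  ≈⟨ assoc _ _ _ ⟨
    (x ⊕ z) ⊕ y  ∎)

  commutes-cancelˡ : ∀ {x y z} → Commutes y x → Commutes (y ⊕ z) x → Commutes z x
  commutes-cancelˡ {x} {y} {z} yx yzx = ⊕-cancelˡ y (begin
    y ⊕ (z ⊕ x)  ≈⟨ assoc _ _ _ ⟨
    (y ⊕ z) ⊕ x  ≈⟨ yzx ⟩
    x ⊕ (y ⊕ z)  ≈⟨ assoc _ _ _ ⟨
    (x ⊕ y) ⊕ z  ≈⟨ ⊕-congʳ yx ⟨
    (y ⊕ x) ⊕ z  ≈⟨ assoc _ _ _ ⟩
    y ⊕ (x ⊕ z)  ∎)

  commutes-resp : ∀ {x y z} → x ≈ y → Commutes x z → Commutes y z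
  commutes-resp x≈y xz = trans (⊕-congʳ (sym x≈y)) (trans xz (⊕-congˡ x≈y))

  -- Each `Commutes` expresses membership of `x` in a coset i y + C(z). Two such memberships put a
  -- positive multiple of `y` into C(z), hence `y` itself by `commutes-root`.
  left-cosets-disjoint : ∀ {x y z i j} → ¬ Commutes y z → i ℕ.< j →
    Commutes (i · y \\ x) z → ¬ Commutes (j · y \\ x) z
  left-cosets-disjoint {x} {y} {z} {i} {j} ¬yz i<j ix jx with ℕ.m≤n⇒∃[o]m+o≡n i<j
  ... | k , ≡.refl = ¬yz (commutes-root k (commutes-cancelʳ jx (commutes-resp (⊕-cancelˡ (i · y) eq) ix)))
    where
    eq : i · y ⊕ (i · y \\ x) ≈ i · y ⊕ (suc k · y ⊕ (j · y \\ x))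
    eq = begin
      i · y ⊕ (i · y \\ x)                 ≈⟨ \\-leftDividesˡ (i · y) x ⟩
      x                                    ≈⟨ \\-leftDividesˡ (j · y) x ⟨
      j · y ⊕ (j · y \\ x)                 ≈⟨ ⊕-congʳ (×-congˡ (≡.sym (ℕ.+-suc i k))) ⟩
      (i ℕ.+ suc k) · y ⊕ (j · y \\ x)     ≈⟨ ⊕-congʳ (×-homo-+ y i (suc k)) ⟩
      (i · y ⊕ suc k · y) ⊕ (j · y \\ x)   ≈⟨ assoc _ _ _ ⟩
      i · y ⊕ (suc k · y ⊕ (j · y \\ x))   ∎

  -- The mirror image, for cosets C(z) + i y. Pairing left cosets of C(x) with right cosets of C(y)
  -- is what lets i y + j x be a common point.
  right-cosets-disjoint : ∀ {x y z i j} → ¬ Commutes y z → i ℕ.< j →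
    Commutes (x // i · y) z → ¬ Commutes (x // j · y) z
  right-cosets-disjoint {x} {y} {z} {i} {j} ¬yz i<j ix jx with ℕ.m≤n⇒∃[o]m+o≡n i<j
  ... | k , ≡.refl = ¬yz (commutes-root k (commutes-cancelˡ jx (commutes-resp (⊕-cancelʳ (i · y) eq) ix)))
    where
    eq : (x // i · y) ⊕ i · y ≈ ((x // j · y) ⊕ suc k · y) ⊕ i · y
    eq = begin
      (x // i · y) ⊕ i · y                 ≈⟨ //-rightDividesˡ (i · y) x ⟩
      x                                    ≈⟨ //-rightDividesˡ (j · y) x ⟨
      (x // j · y) ⊕ j · y                 ≈⟨ ⊕-congˡ (×-congˡ (≡.cong suc (ℕ.+-comm i k))) ⟩
      (x // j · y) ⊕ (suc k ℕ.+ i) · y     ≈⟨ ⊕-congˡ (×-homo-+ y (suc k) i) ⟩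
      (x // j · y) ⊕ (suc k · y ⊕ i · y)   ≈⟨ assoc _ _ _ ⟨
      ((x // j · y) ⊕ suc k · y) ⊕ i · y   ∎

  module Commutative (comm : ∀ x y → Commutes x y) where

    commutativeMonoid : CommutativeMonoid ℓ ℓ
    commutativeMonoid = record
      { isCommutativeMonoid = record { isMonoid = Group.isMonoid group ; comm = comm } }

    open import Algebra.Properties.CommutativeMonoid.Mult commutativeMonoid public
      using (×-distrib-+)

    ⊖-multiple : ∀ m x → m · (⊖ x) ≈ ⊖ (m · x)
    ⊖-multiple m x = inverseʳ-unique (m · x) (m · (⊖ x))
      (trans (sym (×-distrib-+ x (⊖ x) m)) (trans (×-congʳ m (inverseʳ x)) (·-ε m)))

-- Divisible ordered abelian groups: positions and cuts.

pattern lo = zero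
pattern at = suc zero
pattern hi = suc (suc zero)

module DivisibleOrderedAbelianGroup
  {M : Structure L⟨+,<⟩ ℓ} (isOG : IsOrderedGroup M)
  (comm : ∀ x y → OrderedGroupProperties.Commutes isOG x y)
  (divisible : ∀ k x → ∃[ y ] Structure._≈_ M (OrderedGroupProperties._·_ isOG (suc k) y) x)
  (positive : ∃[ x ] IsOrderedGroup._<_ isOG (IsOrderedGroup.ε isOG) x)
  where

  open OrderedGroupProperties isOG
  open Structure M using (Carrier; _≈_)

  open Commutative comm
  open import Algebra.Properties.CommutativeSemigroup
    (CommutativeMonoid.commutativeSemigroup commutativeMonoid)
    using (interchange; x∙yz≈y∙xz)
  open import Relation.Binary.Reasoning.Setoid setoid

  -- The values lie in `Fin 3`, so that having the same position is a decidable equation and the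
  -- positions relative to finitely many points can be counted.
  sgn : Carrier → Carrier → Fin 3
  sgn x y with compare x y
  ... | tri< _ _ _ = lo
  ... | tri≈ _ _ _ = at
  ... | tri> _ _ _ = hi

  sgn-lt : ∀ {x y} → x < y → sgn x y ≡ lo
  sgn-lt {x} {y} x<y with compare x y
  ... | tri< _ _ _ = ≡.refl
  ... | tri≈ x≮y _ _ = contradiction x<y x≮y
  ... | tri> x≮y _ _ = contradiction x<y x≮y

  sgn-eq : ∀ {x y} → x ≈ y → sgn x y ≡ at
  sgn-eq {x} {y} x≈y with compare x y
  ... | tri< _ x≉y _ = contradiction x≈y x≉y
  ... | tri≈ _ _ _ = ≡.refl
  ... | tri> _ x≉y _ = contradiction x≈y x≉y

  sgn-gt : ∀ {x y} → y < x → sgn x y ≡ hi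
  sgn-gt {x} {y} y<x with compare x y
  ... | tri< _ _ y≮x = contradiction y<x y≮x
  ... | tri≈ _ _ y≮x = contradiction y<x y≮x
  ... | tri> _ _ _ = ≡.refl

  lt-sgn : ∀ {x y} → sgn x y ≡ lo → x < y
  lt-sgn {x} {y} s with compare x y
  ... | tri< x<y _ _ = x<y
  lt-sgn () | tri≈ _ _ _
  lt-sgn () | tri> _ _ _

  eq-sgn : ∀ {x y} → sgn x y ≡ at → x ≈ y
  eq-sgn {x} {y} s with compare x y
  ... | tri≈ _ x≈y _ = x≈y
  eq-sgn () | tri< _ _ _
  eq-sgn () | tri> _ _ _

  gt-sgn : ∀ {x y} → sgn x y ≡ hi → y < x
  gt-sgn {x} {y} s with compare x y
  ... | tri> _ _ y<x = y<x
  gt-sgn () | tri< _ _ _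
  gt-sgn () | tri≈ _ _ _

  -- By trichotomy, implications in one direction suffice.
  sgn-transport : ∀ {x y x′ y′} → (x < y → x′ < y′) → (x ≈ y → x′ ≈ y′) → (y < x → y′ < x′) →
    sgn x y ≡ sgn x′ y′
  sgn-transport {x} {y} f g h with compare x y
  ... | tri< x<y _ _ = ≡.sym (sgn-lt (f x<y))
  ... | tri≈ _ x≈y _ = ≡.sym (sgn-eq (g x≈y))
  ... | tri> _ _ y<x = ≡.sym (sgn-gt (h y<x))

  sgn-cong : ∀ {x y x′ y′} → x ≈ x′ → y ≈ y′ → sgn x y ≡ sgn x′ y′
  sgn-cong p q = sgn-transport
    (<-respˡ-≈ p ∘ <-respʳ-≈ q) (λ r → trans (sym p) (trans r q)) (<-respʳ-≈ p ∘ <-respˡ-≈ q)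

  sgn-⊕ : ∀ z {x y} → sgn x y ≡ sgn (x ⊕ z) (y ⊕ z)
  sgn-⊕ z = sgn-transport (<-translateʳ z) ⊕-congʳ (<-translateʳ z)

  sgn-· : ∀ k {x y} → sgn x y ≡ sgn (suc k · x) (suc k · y)
  sgn-· k = sgn-transport (·-mono-< k) (×-congʳ (suc k)) (·-mono-< k)

  sgn-opposite : ∀ {x y} → sgn y x ≡ opposite (sgn x y)
  sgn-opposite {x} {y} with compare x y
  ... | tri< x<y _ _ = sgn-gt x<y
  ... | tri≈ _ x≈y _ = sgn-eq (sym x≈y)
  ... | tri> _ _ y<x = sgn-lt y<x

  sgn-flip : ∀ {x y x′ y′} → sgn x y ≡ sgn x′ y′ → sgn y x ≡ sgn y′ x′
  sgn-flip s = ≡.trans sgn-opposite (≡.trans (≡.cong opposite s) (≡.sym sgn-opposite))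

  ≮-<-trans : ∀ {x y z} → ¬ (y < x) → y < z → x < z
  ≮-<-trans {x} {y} y≮x y<z with compare x y
  ... | tri< x<y _ _ = <-trans x<y y<z
  ... | tri≈ _ x≈y _ = <-respˡ-≈ (sym x≈y) y<z
  ... | tri> _ _ y<x = contradiction y<x y≮x

  -- The sets {x : sgn x z ≡ s} are convex and w lies between x and y.
  sgn-between : ∀ {x y z w} → sgn x z ≡ sgn y z → sgn x w ≢ sgn y w → sgn w z ≡ sgn x z
  sgn-between {x} {y} {z} {w} xz≡yz xw≢yw with compare w z
  ... | tri≈ _ w≈z _ = contradiction
    (≡.trans (sgn-cong refl w≈z) (≡.trans xz≡yz (sgn-cong refl (sym w≈z)))) xw≢yw
  ... | tri< w<z _ _ with sgn x z in xz
  ...   | lo = ≡.refl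
  ...   | at = contradiction (≡.trans (sgn-gt (<-respʳ-≈ (sym (eq-sgn xz)) w<z))
                 (≡.sym (sgn-gt (<-respʳ-≈ (sym (eq-sgn (≡.sym xz≡yz))) w<z)))) xw≢yw
  ...   | hi = contradiction (≡.trans (sgn-gt (<-trans w<z (gt-sgn xz)))
                 (≡.sym (sgn-gt (<-trans w<z (gt-sgn (≡.sym xz≡yz)))))) xw≢yw
  sgn-between {x} {y} {z} {w} xz≡yz xw≢yw | tri> _ _ z<w with sgn x z in xz
  ...   | hi = ≡.refl
  ...   | at = contradiction (≡.trans (sgn-lt (<-respˡ-≈ (sym (eq-sgn xz)) z<w))
                 (≡.sym (sgn-lt (<-respˡ-≈ (sym (eq-sgn (≡.sym xz≡yz))) z<w)))) xw≢yw
  ...   | lo = contradiction (≡.trans (sgn-lt (<-trans (lt-sgn xz) z<w))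
                 (≡.sym (sgn-lt (<-trans (lt-sgn (≡.sym xz≡yz)) z<w)))) xw≢yw

  dense : ∀ {x y} → x < y → ∃[ z ] (x < z × z < y)
  -- `divisible 1` divides by 2, so `z` is the midpoint.
  dense {x} {y} x<y with divisible 1 (x ⊕ y)
  ... | z , 2z≈x+y =
    z , halve (<-respʳ-≈ (sym 2z≈x+y) (<-respˡ-≈ (double x) (<-translateˡ x x<y)))
      , halve (<-respˡ-≈ (sym 2z≈x+y) (<-respʳ-≈ (double y) (<-translateʳ y x<y)))
    where
    halve : ∀ {x y} → 2 · x < 2 · y → x < y
    halve 2x<2y = lt-sgn (≡.trans (sgn-· 1) (sgn-lt 2x<2y))

    double : ∀ x → x ⊕ x ≈ 2 · x
    double x = ⊕-congˡ (sym (identityʳ x))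

  -- `positive` rules out the trivial group, whose order has endpoints.
  greater : ∀ x → ∃[ y ] x < y
  greater x = x ⊕ proj₁ positive , x<x⊕y x (proj₂ positive)

  smaller : ∀ x → ∃[ y ] y < x
  smaller x = x // d , <-respʳ-≈ (//-rightDividesˡ d x) (x<x⊕y (x // d) (proj₂ positive))
    where
    d : Carrier
    d = proj₁ positive

  lower-bound : ∀ B → ∃[ l ] All (l <_) B
  lower-bound [] = ε , []
  lower-bound (b ∷ B) with lower-bound B
  ... | l , l<B with compare l b
  ...   | tri< l<b _ _ = l , l<b ∷ l<B
  ...   | tri≈ l≮b _ _ = proj₁ (smaller b) , proj₂ (smaller b)
            ∷ All.map (<-trans (proj₂ (smaller b)) ∘ ≮-<-trans l≮b) l<B
  ...   | tri> l≮b _ _ = proj₁ (smaller b) , proj₂ (smaller b)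
            ∷ All.map (<-trans (proj₂ (smaller b)) ∘ ≮-<-trans l≮b) l<B

  room-above : ∀ l {B} → All (l <_) B → ∃[ x ] (l < x × All (x <_) B)
  room-above l [] = proj₁ (greater l) , proj₂ (greater l) , []
  room-above l {b ∷ B} (l<b ∷ l<B) with room-above l l<B | dense l<b
  ... | x , l<x , x<B | z , l<z , z<b with compare x b
  ...   | tri< x<b _ _ = x , l<x , x<b ∷ x<B
  ...   | tri≈ x≮b _ _ = z , l<z , z<b ∷ All.map (<-trans z<b ∘ ≮-<-trans x≮b) x<B
  ...   | tri> x≮b _ _ = z , l<z , z<b ∷ All.map (<-trans z<b ∘ ≮-<-trans x≮b) x<B

  maximum : ∀ {p} {P : Carrier → Set p} {A} l → P l → All P A → ∃[ m ] (P m × All (λ a → ¬ (m < a)) A)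
  maximum l Pl [] = l , Pl , []
  maximum {A = a ∷ A} l Pl (Pa ∷ PA) with maximum l Pl PA
  ... | m , Pm , A≤m with compare m a
  ...   | tri< m<a _ _ = a , Pa , <-irrefl refl ∷ All.map (λ m≮b a<b → m≮b (<-trans m<a a<b)) A≤m
  ...   | tri≈ m≮a _ _ = m , Pm , m≮a ∷ A≤m
  ...   | tri> m≮a _ _ = m , Pm , m≮a ∷ A≤m

  -- Starting the maximum of `A` at a lower bound of `B` covers the case of empty `A` and keeps the
  -- result below `B`.
  between : ∀ {A B} → All (λ a → All (a <_) B) A → ∃[ x ] (All (_< x) A × All (x <_) B)
  between {A} {B} A<B with lower-bound B
  ... | l , l<B with maximum l l<B A<B
  ...   | m , m<B , A≤m with room-above m m<B
  ...     | x , m<x , x<B = x , All.map (λ m≮a → ≮-<-trans m≮a m<x) A≤m , x<B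

  -- One back-and-forth step between finite sets {e i} and {e′ i} of the same order type.
  copy-cut : ∀ {I : Set} (P : List I) (e e′ : I → Carrier) →
    (∀ {i j} → i ∈ᴸ P → j ∈ᴸ P → sgn (e i) (e j) ≡ sgn (e′ i) (e′ j)) →
    ∀ x′ → ∃[ x ] (∀ {i} → i ∈ᴸ P → sgn x (e i) ≡ sgn x′ (e′ i))
  copy-cut {I} P e e′ same x′ with Any.any? (λ i → sgn x′ (e′ i) ≟ at) P
  ... | yes x′∈e′ with find x′∈e′
  ...   | i , i∈P , x′≈e′i = e i , λ j∈P → ≡.trans (same i∈P j∈P) (sgn-cong (sym (eq-sgn x′≈e′i)) refl)
  -- Now `x′` lies in a gap of the points `e′ i`. As `same` preserves their order, the corresponding
  -- `e i` form a cut, which density and the lack of endpoints fill.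
  copy-cut {I} P e e′ same x′ | no x′∉e′ with between {map e below} {map e above} below<above
    where
    side : I → Fin 3
    side i = sgn x′ (e′ i)

    below above : List I
    below = filter (λ i → side i ≟ hi) P
    above = filter (λ i → side i ≟ lo) P

    below<above : All (λ a → All (a <_) (map e above)) (map e below)
    below<above = All.map⁺ (All.tabulate λ i∈ → All.map⁺ (All.tabulate λ j∈ →
      let i∈P , i-gt = ∈-filter⁻ (λ i → side i ≟ hi) {xs = P} i∈
          j∈P , j-lt = ∈-filter⁻ (λ i → side i ≟ lo) {xs = P} j∈
      in lt-sgn (≡.trans (same i∈P j∈P) (sgn-lt (<-trans (gt-sgn i-gt) (lt-sgn j-lt))))))
  ... | x , below<x , x<above = x , λ {i} i∈P → locate i i∈P (sgn x′ (e′ i)) ≡.refl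
    where
    locate : ∀ i → i ∈ᴸ P → ∀ s → sgn x′ (e′ i) ≡ s → sgn x (e i) ≡ s
    locate i i∈P lo s = sgn-lt (All.lookup x<above (∈-map⁺ e (∈-filter⁺ (λ i → sgn x′ (e′ i) ≟ lo) i∈P s)))
    locate i i∈P at s = contradiction (lose i∈P s) x′∉e′
    locate i i∈P hi s = sgn-gt (All.lookup below<x (∈-map⁺ e (∈-filter⁺ (λ i → sgn x′ (e′ i) ≟ hi) i∈P s)))

  -- Linear comparisons and quantifier elimination.

  value : Vec ℕ n → Vec Carrier n → Carrier
  value [] [] = ε
  value (c ∷ s) (x ∷ ρ) = c · x ⊕ value s ρ

  value-zero : (ρ : Vec Carrier n) → value (Vec.replicate n 0) ρ ≈ ε
  value-zero [] = refl
  value-zero (x ∷ ρ) = trans (identityˡ _) (value-zero ρ)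

  value-+ : ∀ (s t : Vec ℕ n) ρ → value (Vec.zipWith ℕ._+_ s t) ρ ≈ value s ρ ⊕ value t ρ
  value-+ [] [] [] = sym (identityˡ ε)
  value-+ (c ∷ s) (d ∷ t) (x ∷ ρ) =
    trans (⊕-cong (×-homo-+ x c d) (value-+ s t ρ)) (interchange _ _ _ _)

  value-* : ∀ k (s : Vec ℕ n) ρ → value (Vec.map (k ℕ.*_) s) ρ ≈ k · value s ρ
  value-* k [] [] = sym (·-ε k)
  value-* k (c ∷ s) (x ∷ ρ) =
    trans (⊕-cong (sym (×-assocˡ x k c)) (value-* k s ρ)) (sym (×-distrib-+ _ _ k))

  unit : Fin n → Vec ℕ n
  unit zero = 1 ∷ Vec.replicate _ 0
  unit (suc i) = 0 ∷ unit i

  value-unit : ∀ (i : Fin n) ρ → value (unit i) ρ ≈ lookup ρ i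
  value-unit zero (x ∷ ρ) = trans (⊕-cong (identityʳ x) (value-zero ρ)) (identityʳ x)
  value-unit (suc i) (x ∷ ρ) = trans (identityˡ _) (value-unit i ρ)

  coefficients : Term L⟨+,<⟩ n → Vec ℕ n
  coefficients (var i) = unit i
  coefficients (func plus (s ∷ t ∷ [])) = Vec.zipWith ℕ._+_ (coefficients s) (coefficients t)

  value-coefficients : ∀ (t : Term L⟨+,<⟩ n) ρ → value (coefficients t) ρ ≈ Semantics.eval M t ρ
  value-coefficients (var i) ρ = value-unit i ρ
  value-coefficients (func plus (s ∷ t ∷ [])) ρ =
    trans (value-+ (coefficients s) (coefficients t) ρ)
      (⊕-cong (value-coefficients s ρ) (value-coefficients t ρ))

  -- Both sides are kept, because without subtraction the coefficients are natural numbers.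
  Comparison : ℕ → Set
  Comparison n = Vec ℕ n × Vec ℕ n

  sign : Comparison n → Vec Carrier n → Fin 3
  sign (s , t) ρ = sgn (value s ρ) (value t ρ)

  Agree : List (Comparison n) → Vec Carrier n → Vec Carrier n → Set
  Agree F ρ ρ′ = All (λ f → sign f ρ ≡ sign f ρ′) F

  -- (k , s , t) stands for the solution y of (k + 1) y + s = t.
  Endpoint : ℕ → Set
  Endpoint n = ℕ × Comparison n

  root : Endpoint n → Vec Carrier n → Carrier
  root (k , s , t) ρ = proj₁ (divisible k (value t ρ // value s ρ))

  root-solves : ∀ k (s t : Vec ℕ n) ρ → suc k · root (k , s , t) ρ ⊕ value s ρ ≈ value t ρ
  root-solves k s t ρ = trans (⊕-congʳ (proj₂ (divisible k (value t ρ // value s ρ))))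
    (//-rightDividesˡ (value s ρ) (value t ρ))

  -- For c x + s against d x + t: with c = d the variable x cancels; otherwise the sign
  -- depends only on the position of x relative to the solution of c x + s = d x + t.
  flats : List (Comparison (suc n)) → List (Comparison n)
  flats [] = []
  flats ((c ∷ s , d ∷ t) ∷ F) with ℕ.compare c d
  ... | ℕ.less _ _ = flats F
  ... | ℕ.equal _ = (s , t) ∷ flats F
  ... | ℕ.greater _ _ = flats F

  endpoints : List (Comparison (suc n)) → List (Endpoint n)
  endpoints [] = []
  endpoints ((c ∷ s , d ∷ t) ∷ F) with ℕ.compare c d
  -- The larger coefficient is on the right, so the sides are exchanged to leave a positive multiple
  -- of the unknown.
  ... | ℕ.less _ k = (k , t , s) ∷ endpoints F
  ... | ℕ.equal _ = endpoints F
  ... | ℕ.greater _ k = (k , s , t) ∷ endpoints F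

  sign-equal : ∀ c (s t : Vec ℕ n) x ρ → sign (c ∷ s , c ∷ t) (x ∷ ρ) ≡ sign (s , t) ρ
  sign-equal c s t x ρ = ≡.sym (≡.trans (sgn-⊕ (c · x)) (sgn-cong (comm _ _) (comm _ _)))

  -- Multiply `x` and the root by k + 1, then add d x + s to both.
  sign-greater : ∀ d k (s t : Vec ℕ n) x ρ →
    sign (suc (d ℕ.+ k) ∷ s , d ∷ t) (x ∷ ρ) ≡ sgn x (root (k , s , t) ρ)
  sign-greater d k s t x ρ = ≡.sym (≡.trans (sgn-· k) (≡.trans (sgn-⊕ (d · x ⊕ value s ρ)) (sgn-cong
    (begin
      suc k · x ⊕ (d · x ⊕ value s ρ)        ≈⟨ assoc _ _ _ ⟨
      (suc k · x ⊕ d · x) ⊕ value s ρ        ≈⟨ ⊕-congʳ (×-homo-+ x (suc k) d) ⟨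
      (suc k ℕ.+ d) · x ⊕ value s ρ          ≈⟨ ⊕-congʳ (×-congˡ (≡.cong suc (ℕ.+-comm k d))) ⟩
      suc (d ℕ.+ k) · x ⊕ value s ρ          ∎)
    (begin
      suc k · root (k , s , t) ρ ⊕ (d · x ⊕ value s ρ)   ≈⟨ x∙yz≈y∙xz _ _ _ ⟩
      d · x ⊕ (suc k · root (k , s , t) ρ ⊕ value s ρ)   ≈⟨ ⊕-congˡ (root-solves k s t ρ) ⟩
      d · x ⊕ value t ρ                                  ∎))))

  -- Each sign at `x ∷ ρ` is either that of a flat comparison at `ρ` or determined by the position
  -- of `x` relative to a root.
  agree-extend : ∀ (F : List (Comparison (suc n))) {x x′ ρ ρ′} → Agree (flats F) ρ ρ′ →
    All (λ p → sgn x (root p ρ) ≡ sgn x′ (root p ρ′)) (endpoints F) → Agree F (x ∷ ρ) (x′ ∷ ρ′)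
  agree-extend [] _ _ = []
  agree-extend ((c ∷ s , d ∷ t) ∷ F) {x} {x′} {ρ} {ρ′} flat cut with ℕ.compare c d
  agree-extend ((c ∷ s , d ∷ t) ∷ F) {x} {x′} {ρ} {ρ′} flat (p ∷ cut) | ℕ.less _ k =
    sgn-flip (≡.trans (sign-greater c k t s x ρ) (≡.trans p (≡.sym (sign-greater c k t s x′ ρ′))))
      ∷ agree-extend F flat cut
  agree-extend ((c ∷ s , d ∷ t) ∷ F) {x} {x′} {ρ} {ρ′} (p ∷ flat) cut | ℕ.equal _ =
    ≡.trans (sign-equal c s t x ρ) (≡.trans p (≡.sym (sign-equal c s t x′ ρ′)))
      ∷ agree-extend F flat cut
  agree-extend ((c ∷ s , d ∷ t) ∷ F) {x} {x′} {ρ} {ρ′} flat (p ∷ cut) | ℕ.greater _ k =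
    ≡.trans (sign-greater d k s t x ρ) (≡.trans p (≡.sym (sign-greater d k s t x′ ρ′)))
      ∷ agree-extend F flat cut

  -- The inequality between (t - s)/(k + 1) and (t′ - s′)/(l + 1), with denominators cleared and
  -- negative terms moved across.
  resultant : Endpoint n → Endpoint n → Comparison n
  resultant (k , s , t) (l , s′ , t′) =
    Vec.zipWith ℕ._+_ (Vec.map (suc l ℕ.*_) t) (Vec.map (suc k ℕ.*_) s′) ,
    Vec.zipWith ℕ._+_ (Vec.map (suc k ℕ.*_) t′) (Vec.map (suc l ℕ.*_) s)

  value-combination : ∀ k l (s t : Vec ℕ n) ρ →
    value (Vec.zipWith ℕ._+_ (Vec.map (k ℕ.*_) s) (Vec.map (l ℕ.*_) t)) ρ ≈ k · value s ρ ⊕ l · value t ρ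
  value-combination k l s t ρ =
    trans (value-+ (Vec.map (k ℕ.*_) s) (Vec.map (l ℕ.*_) t) ρ) (⊕-cong (value-* k s ρ) (value-* l t ρ))

  -- Multiply both roots by (k + 1)(l + 1) and add (l + 1) s + (k + 1) s′ to both sides.
  sign-resultant : ∀ (p q : Endpoint n) ρ → sign (resultant p q) ρ ≡ sgn (root p ρ) (root q ρ)
  sign-resultant (k , s , t) (l , s′ , t′) ρ = ≡.sym
    (≡.trans (sgn-· l) (≡.trans (sgn-· k) (≡.trans (sgn-⊕ (suc l · value s ρ ⊕ suc k · value s′ ρ))
      (sgn-cong left right))))
    where
    r r′ : Carrier
    r = root (k , s , t) ρ
    r′ = root (l , s′ , t′) ρ

    swap : suc k · (suc l · r) ≈ suc l · (suc k · r)
    swap = trans (×-assocˡ r (suc k) (suc l)) (trans (×-congˡ (ℕ.*-comm (suc k) (suc l)))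
      (sym (×-assocˡ r (suc l) (suc k))))

    left : suc k · (suc l · r) ⊕ (suc l · value s ρ ⊕ suc k · value s′ ρ) ≈
           value (proj₁ (resultant (k , s , t) (l , s′ , t′))) ρ
    left = begin
      suc k · (suc l · r) ⊕ (suc l · value s ρ ⊕ suc k · value s′ ρ)
        ≈⟨ assoc _ _ _ ⟨
      (suc k · (suc l · r) ⊕ suc l · value s ρ) ⊕ suc k · value s′ ρ
        ≈⟨ ⊕-congʳ (⊕-congʳ swap) ⟩
      (suc l · (suc k · r) ⊕ suc l · value s ρ) ⊕ suc k · value s′ ρ
        ≈⟨ ⊕-congʳ (×-distrib-+ _ _ (suc l)) ⟨
      suc l · (suc k · r ⊕ value s ρ) ⊕ suc k · value s′ ρ
        ≈⟨ ⊕-congʳ (×-congʳ (suc l) (root-solves k s t ρ)) ⟩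
      suc l · value t ρ ⊕ suc k · value s′ ρ
        ≈⟨ value-combination (suc l) (suc k) t s′ ρ ⟨
      _ ∎

    right : suc k · (suc l · r′) ⊕ (suc l · value s ρ ⊕ suc k · value s′ ρ) ≈
            value (proj₂ (resultant (k , s , t) (l , s′ , t′))) ρ
    right = begin
      suc k · (suc l · r′) ⊕ (suc l · value s ρ ⊕ suc k · value s′ ρ)
        ≈⟨ ⊕-congˡ (comm _ _) ⟩
      suc k · (suc l · r′) ⊕ (suc k · value s′ ρ ⊕ suc l · value s ρ)
        ≈⟨ assoc _ _ _ ⟨
      (suc k · (suc l · r′) ⊕ suc k · value s′ ρ) ⊕ suc l · value s ρ
        ≈⟨ ⊕-congʳ (×-distrib-+ _ _ (suc k)) ⟨
      suc k · (suc l · r′ ⊕ value s′ ρ) ⊕ suc l · value s ρ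
        ≈⟨ ⊕-congʳ (×-congʳ (suc k) (root-solves l s′ t′ ρ)) ⟩
      suc k · value t′ ρ ⊕ suc l · value s ρ
        ≈⟨ value-combination (suc k) (suc l) t′ s ρ ⟨
      _ ∎

  -- As in Fourier-Motzkin elimination: what remains is the comparisons free of the first variable
  -- and the mutual order of the endpoints.
  eliminate : List (Comparison (suc n)) → List (Comparison n)
  eliminate F = flats F List.++ List.cartesianProductWith resultant (endpoints F) (endpoints F)

  -- Agreement on the resultants says that the roots at `ρ` and at `ρ′` have the same order type, so
  -- `copy-cut` finds a partner for `x′`.
  eliminate-extends : ∀ (F : List (Comparison (suc n))) {ρ ρ′} → Agree (eliminate F) ρ ρ′ →
    ∀ x′ → ∃[ x ] Agree F (x ∷ ρ) (x′ ∷ ρ′)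
  eliminate-extends F {ρ} {ρ′} agree x′ with
    copy-cut (endpoints F) (λ p → root p ρ) (λ p → root p ρ′)
      (λ {p} {q} p∈ q∈ → ≡.trans (≡.sym (sign-resultant p q ρ)) (≡.trans
        (All.lookup (All.++⁻ʳ (flats F) agree) (∈-cartesianProductWith⁺ resultant p∈ q∈))
        (sign-resultant p q ρ′)))
      x′
  ... | x , same = x , agree-extend F (All.++⁻ˡ (flats F) agree) (All.tabulate same)

  -- Quantifier elimination, semantically: the comparisons on which the truth of φ depends.
  decisive : Formula L⟨+,<⟩ n → List (Comparison n)
  decisive (s ≐ t) = (coefficients s , coefficients t) ∷ []
  decisive (rel less (s ∷ t ∷ [])) = (coefficients s , coefficients t) ∷ []
  decisive bot = []
  decisive (φ ⇒ χ) = decisive φ List.++ decisive χ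
  decisive (all φ) = eliminate (decisive φ)

  sgn-eval : ∀ (s t : Term L⟨+,<⟩ n) {ρ ρ′} → Agree ((coefficients s , coefficients t) ∷ []) ρ ρ′ →
    sgn (Semantics.eval M s ρ) (Semantics.eval M t ρ) ≡ sgn (Semantics.eval M s ρ′) (Semantics.eval M t ρ′)
  sgn-eval s t {ρ} {ρ′} (p ∷ []) =
    ≡.trans (≡.sym (sgn-cong (value-coefficients s ρ) (value-coefficients t ρ)))
      (≡.trans p (sgn-cong (value-coefficients s ρ′) (value-coefficients t ρ′)))

  -- Induction on the formula. An implication uses the symmetry of agreement for its antecedent, and
  -- a quantifier uses one back-and-forth step.
  Sat-agree : ∀ (φ : Formula L⟨+,<⟩ n) {ρ ρ′} → Agree (decisive φ) ρ ρ′ → Sat M φ ρ → Sat M φ ρ′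
  Sat-agree (s ≐ t) agree s≈t = eq-sgn (≡.trans (≡.sym (sgn-eval s t agree)) (sgn-eq s≈t))
  Sat-agree (rel less (s ∷ t ∷ [])) agree s<t = lt-sgn (≡.trans (≡.sym (sgn-eval s t agree)) (sgn-lt s<t))
  Sat-agree (φ ⇒ χ) {ρ} {ρ′} agree φ⇒χ =
    Sat-agree χ {ρ} {ρ′} (All.++⁻ʳ (decisive φ) agree) ∘ φ⇒χ ∘
      Sat-agree φ {ρ′} {ρ} (All.map ≡.sym (All.++⁻ˡ (decisive φ) agree))
  Sat-agree (all φ) {ρ} {ρ′} agree ∀φ x′ with eliminate-extends (decisive φ) {ρ} {ρ′} agree x′
  ... | x , agree′ = Sat-agree φ {x ∷ ρ} {x′ ∷ ρ′} agree′ (∀φ x)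

  -- The points where the truth of χ can change as its first variable moves. The length of the list
  -- depends on χ alone, which gives the uniform bound.
  boundary : Formula L⟨+,<⟩ (suc n) → List (Endpoint n)
  boundary χ = endpoints (decisive χ)

  -- The contrapositive of `Sat-agree`: the parameters are the same, so the flat comparisons agree
  -- and only positions relative to roots can differ.
  separated : ∀ (χ : Formula L⟨+,<⟩ (suc n)) {x x′ ρ} → Sat M χ (x ∷ ρ) → ¬ Sat M χ (x′ ∷ ρ) →
    Any (λ p → sgn x (root p ρ) ≢ sgn x′ (root p ρ)) (boundary χ)
  separated χ {x} {x′} {ρ} sat unsat =
    All.¬All⇒Any¬ (λ p → sgn x (root p ρ) ≟ sgn x′ (root p ρ)) (boundary χ)
    λ same → unsat (Sat-agree χ (agree-extend (decisive χ) (All.universal (λ _ → ≡.refl) _) same) sat)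

-- Classical logic and transfer of the ordered group axioms.

module Classical (em : ∀ {a : Level} → ExcludedMiddle a) where

  dne : ∀ {a} {A : Set a} → ¬ ¬ A → A
  dne = decidable-stable em

  -- Sat of ex φ and of φ ∧ χ unfolds to the negations below.
  ∃⁺ : ∀ {a p c} {A : Set a} {P : A → Set p} → ∃[ x ] P x → (∀ x → P x → ⊥ {c}) → ⊥ {c}
  ∃⁺ (x , p) q = q x p

  ∃⁻ : ∀ {a p c} {A : Set a} {P : A → Set p} → ((∀ x → P x → ⊥ {c}) → ⊥ {c}) → ∃[ x ] P x
  ∃⁻ p = dne λ ¬q → lower (p λ x r → lift (¬q (x , r)))

  ∧⁺ : ∀ {a b c} {A : Set a} {B : Set b} → A × B → (A → B → ⊥ {c}) → ⊥ {c}
  ∧⁺ (r , s) p = p r s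

  ∧⁻ : ∀ {a b c} {A : Set a} {B : Set b} → ((A → B → ⊥ {c}) → ⊥ {c}) → A × B
  ∧⁻ p = dne λ ¬q → lower (p λ r s → lift (¬q (r , s)))

  -- A single sentence `groupS` covers the neutral element and inverses, since inverses must refer
  -- to the element that the outer quantifier provides.
  groupS assocS irreflS transS totalS translateˡS translateʳS : Sentence L⟨+,<⟩
  groupS  = ex (all (((var #1 ⊞ var #0 ≐ var #0) ∧ (var #0 ⊞ var #1 ≐ var #0))
                     ∧ ex ((var #0 ⊞ var #1 ≐ var #2) ∧ (var #1 ⊞ var #0 ≐ var #2))))
  assocS  = all (all (all ((var #2 ⊞ var #1) ⊞ var #0 ≐ var #2 ⊞ (var #1 ⊞ var #0))))
  irreflS = all (neg (var #0 ≺ var #0))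
  transS  = all (all (all (var #2 ≺ var #1 ⇒ var #1 ≺ var #0 ⇒ var #2 ≺ var #0)))
  totalS  = all (all (neg (var #1 ≺ var #0) ⇒ neg (var #1 ≐ var #0) ⇒ var #0 ≺ var #1))
  translateˡS = all (all (all (var #1 ≺ var #0 ⇒ (var #2 ⊞ var #1) ≺ (var #2 ⊞ var #0))))
  translateʳS = all (all (all (var #1 ≺ var #0 ⇒ (var #1 ⊞ var #2) ≺ (var #0 ⊞ var #2))))

  isOrderedGroup-transfer : (M : Structure L⟨+,<⟩ ℓ) (N : Structure L⟨+,<⟩ ℓ′) →
    (∀ φ → Sat M φ [] → Sat N φ []) → IsOrderedGroup M → IsOrderedGroup N
  isOrderedGroup-transfer M N M≼N isOG = record
    { ε = e
    ; ⊖_ = inv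
    ; isGroup = record
      { isMonoid = record
        { isSemigroup = record
          { isMagma = record
            { isEquivalence = isEquivalence
            ; ∙-cong = ∙-cong
            }
          ; assoc = assoc
          }
        ; identity = idˡ , idʳ
        }
      ; inverse = invˡ , invʳ
      ; ⁻¹-cong = inv-cong
      }
    ; isStrictTotalOrder = record
      { isStrictPartialOrder = record
        { isEquivalence = isEquivalence
        ; irrefl = <-irrefl
        ; trans = <-trans
        ; <-resp-≈ = (λ y≈z → relI-resp less (refl ∷ y≈z ∷ []))
                   , λ y≈z → relI-resp less (y≈z ∷ refl ∷ [])
        }
      ; compare = cmp
      }
    ; <-translateˡ = λ z → M≼N translateˡS (λ z _ _ → G.<-translateˡ z) z _ _
    ; <-translateʳ = λ z → M≼N translateʳS (λ z _ _ → G.<-translateʳ z) z _ _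
    }
    where
    module G = IsOrderedGroup isOG
    module O = IsStrictTotalOrder G.isStrictTotalOrder
    open Structure N
    open Setoid carrierSetoid using (isEquivalence; refl; sym; trans)

    _⊕_ : Carrier → Carrier → Carrier
    x ⊕ y = funI plus (x ∷ y ∷ [])

    _<_ : Carrier → Carrier → Set _
    x < y = relI less (x ∷ y ∷ [])

    group-axioms : ∃[ e ] ∀ x →
      ((e ⊕ x) ≈ x × (x ⊕ e) ≈ x) × (∃[ y ] ((y ⊕ x) ≈ e × (x ⊕ y) ≈ e))
    group-axioms with ∃⁻ (M≼N groupS (∃⁺ (G.ε , λ x → ∧⁺
      ( ∧⁺ (IsGroup.identityˡ G.isGroup x , IsGroup.identityʳ G.isGroup x)
      , ∃⁺ (G.⊖ x , ∧⁺ (IsGroup.inverseˡ G.isGroup x , IsGroup.inverseʳ G.isGroup x))))))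
    ... | e , p = e , λ x → ∧⁻ (proj₁ (∧⁻ (p x))) , (proj₁ (inverse x p) , ∧⁻ (proj₂ (inverse x p)))
      where inverse = λ x p → ∃⁻ (proj₂ (∧⁻ (p x)))

    e : Carrier
    e = proj₁ group-axioms

    identities : ∀ x → (e ⊕ x) ≈ x × (x ⊕ e) ≈ x
    identities x = proj₁ (proj₂ group-axioms x)

    inverses : ∀ x → ∃[ y ] ((y ⊕ x) ≈ e × (x ⊕ y) ≈ e)
    inverses x = proj₂ (proj₂ group-axioms x)

    inv : Carrier → Carrier
    inv x = proj₁ (inverses x)

    ∙-cong : ∀ {x y z w} → x ≈ y → z ≈ w → (x ⊕ z) ≈ (y ⊕ w)
    ∙-cong p q = funI-cong plus (p ∷ q ∷ [])

    assoc : ∀ x y z → ((x ⊕ y) ⊕ z) ≈ (x ⊕ (y ⊕ z))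
    assoc = M≼N assocS (IsGroup.assoc G.isGroup)

    idˡ = λ x → proj₁ (identities x)
    idʳ = λ x → proj₂ (identities x)
    invˡ = λ x → proj₁ (proj₂ (inverses x))
    invʳ = λ x → proj₂ (proj₂ (inverses x))

    -- Inverses were chosen separately for each element, so congruence has to come from their
    -- uniqueness.
    inv-cong : ∀ {x y} → x ≈ y → inv x ≈ inv y
    inv-cong {x} {y} x≈y = begin
      inv x                 ≈⟨ idʳ _ ⟨
      inv x ⊕ e             ≈⟨ ∙-cong refl (invʳ y) ⟨
      inv x ⊕ (y ⊕ inv y)   ≈⟨ assoc _ _ _ ⟨
      (inv x ⊕ y) ⊕ inv y   ≈⟨ ∙-cong (∙-cong refl (sym x≈y)) refl ⟩
      (inv x ⊕ x) ⊕ inv y   ≈⟨ ∙-cong (invˡ x) refl ⟩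
      e ⊕ inv y             ≈⟨ idˡ _ ⟩
      inv y ∎
      where open import Relation.Binary.Reasoning.Setoid carrierSetoid

    <-irrefl : ∀ {x y} → x ≈ y → ¬ (x < y)
    <-irrefl {x} x≈y x<y =
      lower (M≼N irreflS (λ z z<z → lift (O.irrefl (IsGroup.refl G.isGroup) z<z)) x
        (relI-resp less (refl ∷ sym x≈y ∷ []) x<y))

    <-trans : ∀ {x y z} → x < y → y < z → x < z
    <-trans x<y y<z = M≼N transS (λ _ _ _ → O.trans) _ _ _ x<y y<z

    M-total : Sat M totalS []
    M-total x y x≮y x≉y with O.compare x y
    ... | tri< x<y _ _ = ⊥-elim (lower (x≮y x<y))
    ... | tri≈ _ x≈y _ = ⊥-elim (lower (x≉y x≈y))
    ... | tri> _ _ y<x = y<x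

    cmp : Trichotomous _≈_ _<_
    cmp x y with em {P = x < y} | em {P = x ≈ y}
    ... | yes x<y | _ = tri< x<y (λ x≈y → <-irrefl x≈y x<y) λ y<x → <-irrefl refl (<-trans x<y y<x)
    ... | no x≮y | yes x≈y = tri≈ x≮y x≈y λ y<x → <-irrefl (sym x≈y) y<x
    ... | no x≮y | no x≉y = tri> x≮y x≉y
      (M≼N totalS M-total x y (λ p → lift (x≮y p)) (λ p → lift (x≉y p)))

  -- `multiple k` has k + 1 copies, hence the predecessor; the formula means divisibility by `m`
  -- only for nonzero `m`.
  divides : ℕ → Fin n → Formula L⟨+,<⟩ n
  divides m v = ex (multiple (ℕ.pred m) (var zero) ≐ var (suc v))

  module _ {M : Structure L⟨+,<⟩ ℓ} (isOG : IsOrderedGroup M) where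
    open OrderedGroupProperties isOG
    open Structure M using (Carrier; _≈_)

    eval-multiple-pred : ∀ m .{{_ : ℕ.NonZero m}} (t : Term L⟨+,<⟩ n) ρ →
      Semantics.eval M (multiple (ℕ.pred m) t) ρ ≈ m · Semantics.eval M t ρ
    eval-multiple-pred (suc m) = eval-multiple m

    divides⁺ : ∀ m .{{_ : ℕ.NonZero m}} (v : Fin n) (ρ : Vec Carrier n) →
      ∃[ z ] m · z ≈ lookup ρ v → Sat M (divides m v) ρ
    divides⁺ m v ρ (z , mz≈x) = ∃⁺ (z , trans (eval-multiple-pred m (var zero) (z ∷ ρ)) mz≈x)

    divides⁻ : ∀ m .{{_ : ℕ.NonZero m}} (v : Fin n) (ρ : Vec Carrier n) →
      Sat M (divides m v) ρ → ∃[ z ] m · z ≈ lookup ρ v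
    divides⁻ m v ρ p with ∃⁻ p
    ... | z , mz≈x = z , trans (sym (eval-multiple-pred m (var zero) (z ∷ ρ))) mz≈x

  -- The monster model, and grids of definable sets in it.

  module Monster {g k u : Level} {G : OrderedGroup g} {κ : Set k}
                 (𝓤 : MonsterModel (Th (asStructure G)) κ u) where
    open MonsterModel 𝓤 using (structure; models; large; saturated)
    open Structure structure using (Carrier; _≈_)

    abstract
      isOG : IsOrderedGroup structure
      isOG = isOrderedGroup-transfer (asStructure G) structure models (asStructure-isOrderedGroup G)

    open OrderedGroupProperties isOG

    -- `Th` is complete: if φ failed in `G`, its negation would hold in the monster model.
    reflects : ∀ φ → Sat structure φ [] → Sat (asStructure G) φ []
    reflects φ s = dne λ ¬p → lower (models (neg φ) (λ p → lift (¬p p)) s)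

    Holds : PFormula L⟨+,<⟩ Carrier n → Vec Carrier n → Set u
    Holds = PSat structure (λ c → c)

    -- Disjointness within each family supplies all negated formulas, so each grid point realizes
    -- its whole type and finite satisfiability is immediate.
    grid⇒¬DpSmall : ∀ (φ : ℕ → PFormula L⟨+,<⟩ Carrier 1) {m} (ψ : Formula L⟨+,<⟩ (1 ℕ.+ m)) b →
      (∀ {i j} x → i ℕ.< j → Holds (φ i) x → ¬ Holds (φ j) x) →
      (∀ {i j} x → i ℕ.< j → Holds (ψ ⟨ b i ⟩) x → ¬ Holds (ψ ⟨ b j ⟩) x) →
      (∀ i j → ∃[ x ] (Holds (φ i) x × Holds (ψ ⟨ b j ⟩) x)) →
      ¬ DpSmall 𝓤
    grid⇒¬DpSmall φ {m} ψ b φ-disjoint ψ-disjoint grid small =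
      small (φ , m , ψ , b , λ i j Φ Φ⊆p → point i j , All.map (sat i j) Φ⊆p)
      where
      point : ∀ i j → Vec Carrier 1
      point i j = proj₁ (grid i j)

      unique : ∀ (χ : ℕ → PFormula L⟨+,<⟩ Carrier 1) →
        (∀ {i j} x → i ℕ.< j → Holds (χ i) x → ¬ Holds (χ j) x) →
        ∀ {i j} x → i ≢ j → Holds (χ j) x → ¬ Holds (χ i) x
      unique χ disjoint {i} {j} x i≢j xj xi with ℕ.<-cmp i j
      ... | tri< i<j _ _ = disjoint x i<j xi xj
      ... | tri≈ _ i≡j _ = i≢j i≡j
      ... | tri> _ _ j<i = disjoint x j<i xj xi

      sat : ∀ i j {χ} → χ ∈ dpType 𝓤 ｛ (var zero ≐ var zero) ⟨ [] ⟩ ｝ φ ψ b i j → Holds χ (point i j)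
      sat i j (inj₁ ≡.refl) = refl
      sat i j (inj₂ (inj₁ ≡.refl)) = proj₁ (proj₂ (grid i j))
      sat i j (inj₂ (inj₂ (inj₁ ≡.refl))) = proj₂ (proj₂ (grid i j))
      sat i j (inj₂ (inj₂ (inj₂ (inj₁ (i′ , i′≢i , ≡.refl))))) =
        λ s → lift (unique φ φ-disjoint (point i j) i′≢i (proj₁ (proj₂ (grid i j))) s)
      sat i j (inj₂ (inj₂ (inj₂ (inj₂ (j′ , j′≢j , ≡.refl))))) =
        λ s → lift (unique (λ j → ψ ⟨ b j ⟩) ψ-disjoint (point i j) j′≢j (proj₂ (proj₂ (grid i j))) s)

    -- Dp-smallness implies commutativity.

    noncommuting⇒¬DpSmall : ∀ {x y} → ¬ Commutes x y → ¬ DpSmall 𝓤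
    noncommuting⇒¬DpSmall {x} {y} ¬xy = grid⇒¬DpSmall φ ψ b
      (λ { (_ ∷ []) → left-cosets-disjoint (¬xy ∘ sym) })
      (λ { (_ ∷ []) → right-cosets-disjoint ¬xy })
      -- Removing i y on the left leaves j x, which commutes with `x`; removing j x on the right
      -- leaves i y, which commutes with `y`.
      λ i j → (i · y ⊕ j · x ∷ [])
            , commutes-resp (sym (\\-leftDividesʳ (i · y) (j · x))) (conjugate-multiple refl j)
            , commutes-resp (sym (//-rightDividesʳ (j · x) (i · y))) (conjugate-multiple refl i)
      where
      -- `φ i` defines i y + C(x), and ψ with parameters `b j` defines C(y) + j x.
      φ : ℕ → PFormula L⟨+,<⟩ Carrier 1
      φ i = (((var #1 ⊞ var #0) ⊞ var #2) ≐ (var #2 ⊞ (var #1 ⊞ var #0))) ⟨ ⊖ (i · y) ∷ x ∷ [] ⟩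

      ψ : Formula L⟨+,<⟩ 3
      ψ = ((var #0 ⊞ var #1) ⊞ var #2) ≐ (var #2 ⊞ (var #0 ⊞ var #1))

      b : ℕ → Vec Carrier 2
      b j = ⊖ (j · x) ∷ y ∷ []

    DpSmall⇒commutative : DpSmall 𝓤 → ∀ x y → Commutes x y
    DpSmall⇒commutative small x y = dne λ ¬xy → noncommuting⇒¬DpSmall ¬xy small

    -- Dp-smallness implies divisibility.

    countable-saturation : (θ : ℕ → Formula L⟨+,<⟩ 2) (h : Carrier) →
      (∀ N → ∃[ x ] (∀ i → i ℕ.≤ N → Sat structure (θ i) (x ∷ h ∷ []))) →
      ∃[ x ] (∀ i → Sat structure (θ i) (x ∷ h ∷ []))
    countable-saturation θ h finitely = realize (saturated small (λ _ → h) p consistent)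
      where
      A : Set k
      A = Lift k ⊤

      -- The only parameter is `h`. If κ embedded into a one-element type, it would have at most one
      -- element and so embed into the sentences, against `large`.
      small : Small κ A
      small f = large record
        { to = λ _ → bot ; cong = λ _ → ≡.refl ; injective = λ _ → Injection.injective f ≡.refl }

      χ : ℕ → PFormula L⟨+,<⟩ A 1
      χ i = θ i ⟨ _ ∷ [] ⟩

      p : PartialType L⟨+,<⟩ A 1
      p ξ = ∃[ i ] ξ ≡ χ i

      bounded : ∀ {Φ} → All (_∈ p) Φ → ∃[ N ] All (λ ξ → ∃[ i ] (i ℕ.≤ N × ξ ≡ χ i)) Φ
      bounded [] = 0 , []
      bounded ((i , eq) ∷ ps) with bounded ps
      ... | N , qs = i ℕ.⊔ N , (i , ℕ.m≤m⊔n i N , eq)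
        ∷ All.map (λ (j , j≤N , eq) → j , ℕ.≤-trans j≤N (ℕ.m≤n⊔m i N) , eq) qs

      consistent : Consistent structure (λ _ → h) p
      consistent Φ Φ⊆p with bounded Φ⊆p
      ... | N , qs with finitely N
      ...   | x , sat = (x ∷ []) , All.map (λ { (i , i≤N , ≡.refl) → sat i i≤N }) qs

      realize : Realized structure (λ _ → h) p → ∃[ x ] (∀ i → Sat structure (θ i) (x ∷ h ∷ []))
      realize (x ∷ [] , sat) = x , λ i → sat (χ i) (i , ≡.refl)

    module _ (comm : ∀ x y → Commutes x y) where
      open Commutative comm
      open import Relation.Binary.Reasoning.Setoid setoid

      module _ (m : ℕ) .{{_ : ℕ.NonZero m}} (h : Carrier) (ε<h : ε < h) (m∤h : ¬ (∃[ z ] m · z ≈ h)) where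
        power-nonZero : ∀ i → ℕ.NonZero (m ℕ.^ i)
        power-nonZero i = ℕ.m^n≢0 m i

        -- The type of an element above every multiple of `h` and divisible by every power of `m`.
        θ : ℕ → Formula L⟨+,<⟩ 2
        θ i = (multiple i (var #1) ≺ var #0) ∧ divides (m ℕ.^ i) #0

        finitely : ∀ N → ∃[ x ] (∀ i → i ℕ.≤ N → Sat structure (θ i) (x ∷ h ∷ []))
        -- The factor m^N gives divisibility by m^i for i ≤ N. The factor N + 2 exceeds the i + 1
        -- copies of `h` in `multiple i`.
        finitely N = (m ℕ.^ N ℕ.* suc (suc N)) · h , λ i i≤N → ∧⁺
          ( <-respˡ-≈ (sym (eval-multiple i (var #1) (_ ∷ h ∷ [])))
              (·-monoˡ-< ε<h (ℕ.≤-trans (s<s (s≤s i≤N))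
                (ℕ.m≤n*m (suc (suc N)) (m ℕ.^ N) {{power-nonZero N}})))
          , divides⁺ isOG (m ℕ.^ i) {{power-nonZero i}} #0 (_ ∷ h ∷ [])
              ((m ℕ.^ (N ℕ.∸ i) ℕ.* suc (suc N)) · h , (begin
                (m ℕ.^ i) · ((m ℕ.^ (N ℕ.∸ i) ℕ.* suc (suc N)) · h)     ≈⟨ ×-assocˡ h (m ℕ.^ i) _ ⟩
                (m ℕ.^ i ℕ.* (m ℕ.^ (N ℕ.∸ i) ℕ.* suc (suc N))) · h     ≈⟨ ×-congˡ (power-split i≤N) ⟩
                (m ℕ.^ N ℕ.* suc (suc N)) · h ∎)))
          where
          power-split : ∀ {i} → i ℕ.≤ N →
            m ℕ.^ i ℕ.* (m ℕ.^ (N ℕ.∸ i) ℕ.* suc (suc N)) ≡ m ℕ.^ N ℕ.* suc (suc N)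
          power-split {i} i≤N = ≡.trans (≡.sym (ℕ.*-assoc (m ℕ.^ i) _ _)) (≡.cong (ℕ._* suc (suc N))
            (≡.trans (≡.sym (ℕ.^-distribˡ-+-* m i (N ℕ.∸ i))) (≡.cong (m ℕ.^_) (ℕ.m+[n∸m]≡n i≤N))))

        abstract
          w-spec : ∃[ w ] (∀ i → Sat structure (θ i) (w ∷ h ∷ []))
          w-spec = countable-saturation θ h finitely

        w : Carrier
        w = proj₁ w-spec

        w-large : ∀ i → suc i · h < w
        w-large i = <-respˡ-≈ (eval-multiple i (var #1) (w ∷ h ∷ [])) (proj₁ (∧⁻ (proj₂ w-spec i)))

        w-divisible : ∀ i → ∃[ z ] (m ℕ.^ i) · z ≈ w
        w-divisible i =
          divides⁻ isOG (m ℕ.^ i) {{power-nonZero i}} #0 (w ∷ h ∷ []) (proj₂ (∧⁻ (proj₂ w-spec i)))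

        ε<w : ε < w
        ε<w = <-trans (·-positive 0 ε<h) (w-large 0)

        multiple-divisible : ∀ i j → ∃[ z ] (m ℕ.^ i) · z ≈ j · w
        multiple-divisible i j with w-divisible i
        ... | z , eq = j · z , (begin
          (m ℕ.^ i) · (j · z)  ≈⟨ ×-assocˡ z (m ℕ.^ i) j ⟩
          (m ℕ.^ i ℕ.* j) · z  ≈⟨ ×-congˡ (ℕ.*-comm (m ℕ.^ i) j) ⟩
          (j ℕ.* m ℕ.^ i) · z  ≈⟨ ×-assocˡ z j (m ℕ.^ i) ⟨
          j · ((m ℕ.^ i) · z)  ≈⟨ ×-congʳ j eq ⟩
          j · w                ∎)

        power-divides : ∀ i j → ∃[ z ] (m ℕ.^ i) · z ≈ j · w ⊕ (m ℕ.^ i) · h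
        power-divides i j with multiple-divisible i j
        ... | z , eq = z ⊕ h , trans (×-distrib-+ z h (m ℕ.^ i)) (⊕-congʳ eq)

        power-cancel : ∀ i {x y} → (m ℕ.^ i) · x ≈ (m ℕ.^ i) · y → x ≈ y
        power-cancel i eq with m ℕ.^ i | power-nonZero i
        ... | suc l | _ = ·-injective l eq

        -- Since j w is m^(i+1) v for some v, subtracting it and cancelling m^i would leave `h`
        -- divisible by `m`.
        power-indivisible : ∀ i j → ¬ (∃[ z ] (m ℕ.^ suc i) · z ≈ j · w ⊕ (m ℕ.^ i) · h)
        power-indivisible i j (z , eq) with multiple-divisible (suc i) j
        ... | v , eq′ = m∤h (⊖ v ⊕ z , power-cancel i (begin
          (m ℕ.^ i) · (m · (⊖ v ⊕ z))                   ≈⟨ ×-assocˡ _ (m ℕ.^ i) m ⟩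
          (m ℕ.^ i ℕ.* m) · (⊖ v ⊕ z)                   ≈⟨ ×-congˡ (ℕ.*-comm (m ℕ.^ i) m) ⟩
          (m ℕ.^ suc i) · (⊖ v ⊕ z)                     ≈⟨ ×-distrib-+ (⊖ v) z (m ℕ.^ suc i) ⟩
          (m ℕ.^ suc i) · (⊖ v) ⊕ (m ℕ.^ suc i) · z
            ≈⟨ ⊕-cong (trans (⊖-multiple (m ℕ.^ suc i) v) (⊖-cong eq′)) eq ⟩
          ⊖ (j · w) ⊕ (j · w ⊕ (m ℕ.^ i) · h)           ≈⟨ \\-leftDividesʳ (j · w) _ ⟩
          (m ℕ.^ i) · h                                 ∎))

        power-positive : ∀ i → ε < (m ℕ.^ i) · h
        power-positive i with m ℕ.^ i | power-nonZero i
        ... | suc l | _ = ·-positive l ε<h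

        below-next : ∀ i j → j · w ⊕ (m ℕ.^ i) · h < suc j · w
        below-next i j = <-respʳ-≈ (comm (j · w) w) (<-translateˡ (j · w)
          -- The term m^i h is below (m^i + 1) h, which is below `w`.
          (<-trans (·-monoˡ-< ε<h (ℕ.n<1+n (m ℕ.^ i))) (w-large (m ℕ.^ i))))

        -- The set mⁱ𝓤 minus mⁱ⁺¹𝓤, as in an exact valuation.
        φ : ℕ → PFormula L⟨+,<⟩ Carrier 1
        φ i = (divides (m ℕ.^ i) #0 ∧ neg (divides (m ℕ.^ suc i) #0)) ⟨ [] ⟩

        φ⁺ : ∀ i {x} → (∃[ z ] (m ℕ.^ i) · z ≈ x) × ¬ (∃[ z ] (m ℕ.^ suc i) · z ≈ x) → Holds (φ i) (x ∷ [])
        φ⁺ i {x} (d , ¬d) = ∧⁺ (divides⁺ isOG (m ℕ.^ i) {{power-nonZero i}} #0 (x ∷ []) d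
          , λ s → lift (¬d (divides⁻ isOG (m ℕ.^ suc i) {{power-nonZero (suc i)}} #0 (x ∷ []) s)))

        φ⁻ : ∀ i {x} → Holds (φ i) (x ∷ []) → (∃[ z ] (m ℕ.^ i) · z ≈ x) × ¬ (∃[ z ] (m ℕ.^ suc i) · z ≈ x)
        φ⁻ i {x} s = divides⁻ isOG (m ℕ.^ i) {{power-nonZero i}} #0 (x ∷ []) (proj₁ (∧⁻ s))
          , λ d → lower (proj₂ (∧⁻ s) (divides⁺ isOG (m ℕ.^ suc i) {{power-nonZero (suc i)}} #0 (x ∷ []) d))

        φ-disjoint : ∀ {i j x} → i ℕ.< j →
          (∃[ z ] (m ℕ.^ i) · z ≈ x) × ¬ (∃[ z ] (m ℕ.^ suc i) · z ≈ x) →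
          ¬ ((∃[ z ] (m ℕ.^ j) · z ≈ x) × ¬ (∃[ z ] (m ℕ.^ suc j) · z ≈ x))
        φ-disjoint {i} {j} {x} i<j (_ , ¬d) ((z , eq) , _) = ¬d ((m ℕ.^ (j ℕ.∸ suc i)) · z , (begin
          (m ℕ.^ suc i) · ((m ℕ.^ (j ℕ.∸ suc i)) · z)  ≈⟨ ×-assocˡ z (m ℕ.^ suc i) _ ⟩
          (m ℕ.^ suc i ℕ.* m ℕ.^ (j ℕ.∸ suc i)) · z    ≈⟨ ×-congˡ (ℕ.^-distribˡ-+-* m (suc i) (j ℕ.∸ suc i)) ⟨
          (m ℕ.^ (suc i ℕ.+ (j ℕ.∸ suc i))) · z        ≈⟨ ×-congˡ (≡.cong (m ℕ.^_) (ℕ.m+[n∸m]≡n i<j)) ⟩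
          (m ℕ.^ j) · z                                ≈⟨ eq ⟩
          x                                            ∎))

        ψ : Formula L⟨+,<⟩ 3
        ψ = (var #1 ≺ var #0) ∧ (var #0 ≺ var #2)

        b : ℕ → Vec Carrier 2
        b j = j · w ∷ suc j · w ∷ []

        ψ-disjoint : ∀ {i j x} → i ℕ.< j → i · w < x × x < suc i · w → ¬ (j · w < x × x < suc j · w)
        ψ-disjoint {i} i<j (_ , x<) (<x , _) with ℕ.m≤n⇒m<n∨m≡n i<j
        ... | inj₁ si<j = <-asym x< (<-trans (·-monoˡ-< ε<w si<j) <x)
        ... | inj₂ ≡.refl = <-asym x< <x

        positive-indivisible⇒¬DpSmall : ¬ DpSmall 𝓤
        positive-indivisible⇒¬DpSmall = grid⇒¬DpSmall φ ψ b
          (λ { {i} {j} (x ∷ []) i<j xi xj → φ-disjoint {i} {j} {x} i<j (φ⁻ i {x} xi) (φ⁻ j {x} xj) })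
          (λ { {i} {j} (x ∷ []) i<j xi xj → ψ-disjoint {i} {j} {x} i<j (∧⁻ xi) (∧⁻ xj) })
          λ i j → (j · w ⊕ (m ℕ.^ i) · h ∷ [])
                , φ⁺ i {j · w ⊕ (m ℕ.^ i) · h} (power-divides i j , power-indivisible i j)
                , ∧⁺ (x<x⊕y _ (power-positive i) , below-next i j)

      DpSmall⇒divisible : DpSmall 𝓤 → ∀ m .{{_ : ℕ.NonZero m}} x → ∃[ z ] m · z ≈ x
      DpSmall⇒divisible small m x = dne λ m∤x → indivisible m∤x small
        where
        indivisible : ¬ (∃[ z ] m · z ≈ x) → ¬ DpSmall 𝓤
        -- The construction takes a positive element: zero is divisible, and a negative `x` is
        -- replaced by `⊖ x`.
        indivisible m∤x with compare ε x
        ... | tri< ε<x _ _ = positive-indivisible⇒¬DpSmall m x ε<x m∤x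
        ... | tri≈ _ ε≈x _ = contradiction (ε , trans (·-ε m) ε≈x) m∤x
        ... | tri> _ _ x<ε = positive-indivisible⇒¬DpSmall m (⊖ x)
          (<-respʳ-≈ (identityʳ _) (<-respˡ-≈ (inverseˡ x) (<-translateˡ (⊖ x) x<ε)))
          λ (z , eq) → m∤x (⊖ z , trans (⊖-multiple m z) (trans (⊖-cong eq) (⁻¹-involutive x)))

    -- Divisible abelian groups are dp-small: counting cells.

    literal : ∀ {a} {A : Set a} → Dec A → PFormula L⟨+,<⟩ Carrier n → PFormula L⟨+,<⟩ Carrier n
    literal (yes _) χ = χ
    literal (no _) χ = pneg χ

    literal-true : ∀ {a} {A : Set a} (d : Dec A) → A → (χ : PFormula L⟨+,<⟩ Carrier n) → ∀ {x} →
      Holds (literal d χ) x → Holds χ x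
    literal-true (yes _) _ χ h = h
    literal-true (no ¬p) p χ h = contradiction p ¬p

    literal-false : ∀ {a} {A : Set a} (d : Dec A) → ¬ A → (χ : PFormula L⟨+,<⟩ Carrier n) → ∀ {x} →
      Holds (literal d χ) x → ¬ Holds χ x
    literal-false (yes p) ¬p χ h = contradiction p ¬p
    literal-false (no _) _ χ h h′ = lower (h h′)

    Exactly : (ℕ → PFormula L⟨+,<⟩ Carrier 1) → ℕ → ℕ → Carrier → Set u
    Exactly χ N i x = ∀ i′ → i′ ℕ.< N → Holds (literal (i′ ℕ.≟ i) (χ i′)) (x ∷ [])

    -- Consistency is finite satisfiability, so the pattern is cut down to the first `R` rows and
    -- the first `N` columns.
    grid-point : ∀ {φ : ℕ → PFormula L⟨+,<⟩ Carrier 1} {m} {ψ : Formula L⟨+,<⟩ (1 ℕ.+ m)} {b} i j →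
      Consistent structure (λ c → c) (dpType 𝓤 ｛ (var zero ≐ var zero) ⟨ [] ⟩ ｝ φ ψ b i j) →
      ∀ R N → ∃[ x ] (Exactly φ R i x × Exactly (λ j → ψ ⟨ b j ⟩) N j x)
    grid-point {φ} {m} {ψ} {b} i j consistent R N
      with consistent (List.applyUpTo rows R List.++ List.applyUpTo columns N)
             (All.++⁺ (All.applyUpTo⁺₂ rows R row∈) (All.applyUpTo⁺₂ columns N column∈))
      where
      rows columns : ℕ → PFormula L⟨+,<⟩ Carrier 1
      rows i′ = literal (i′ ℕ.≟ i) (φ i′)
      columns j′ = literal (j′ ℕ.≟ j) (ψ ⟨ b j′ ⟩)

      row∈ : ∀ i′ → rows i′ ∈ dpType 𝓤 ｛ (var zero ≐ var zero) ⟨ [] ⟩ ｝ φ ψ b i j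
      row∈ i′ with i′ ℕ.≟ i
      ... | yes ≡.refl = inj₂ (inj₁ ≡.refl)
      ... | no i′≢i = inj₂ (inj₂ (inj₂ (inj₁ (i′ , i′≢i , ≡.refl))))

      column∈ : ∀ j′ → columns j′ ∈ dpType 𝓤 ｛ (var zero ≐ var zero) ⟨ [] ⟩ ｝ φ ψ b i j
      column∈ j′ with j′ ℕ.≟ j
      ... | yes ≡.refl = inj₂ (inj₂ (inj₁ ≡.refl))
      ... | no j′≢j = inj₂ (inj₂ (inj₂ (inj₂ (j′ , j′≢j , ≡.refl))))
    ... | x ∷ [] , sat = x
      , (λ i′ i′<R → All.applyUpTo⁻ _ R (All.++⁻ˡ (List.applyUpTo _ R) sat) i′<R)
      , (λ j′ j′<N → All.applyUpTo⁻ _ N (All.++⁻ʳ (List.applyUpTo _ R) sat) j′<N)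

    module _ (comm : ∀ x y → Commutes x y)
             (divisible : ∀ k x → ∃[ y ] suc k · y ≈ x)
             (positive : ∃[ x ] ε < x) where
      open DivisibleOrderedAbelianGroup isOG comm divisible positive

      module _ (φ : ℕ → PFormula L⟨+,<⟩ Carrier 1) {m} (ψ : Formula L⟨+,<⟩ (1 ℕ.+ m))
               (b : ℕ → Vec Carrier m)
               (consistent : ∀ i j → Consistent structure (λ c → c)
                 (dpType 𝓤 ｛ (var zero ≐ var zero) ⟨ [] ⟩ ｝ φ ψ b i j)) where

        -- One row more than ψ has boundary points, for the final pigeonhole argument.
        R : ℕ
        R = suc (List.length (boundary ψ))

        -- The identity map matches the environment that `PSat` builds.
        row-parameters : ∀ i → Vec Carrier (PFormula.arity (φ i))
        row-parameters i = Vec.map (λ c → c) (PFormula.params (φ i))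

        row-points : ℕ → List Carrier
        row-points i = map (λ p → root p (row-parameters i)) (boundary (PFormula.formula (φ i)))

        points : List Carrier
        points = List.concat (List.applyUpTo row-points R)

        -- An upper bound that counts all sign patterns relative to `points`, whether or not they
        -- occur.
        cells : ℕ
        cells = 3 ℕ.^ List.length points

        cell : Carrier → Fin cells
        cell x = funToFin (λ p → sgn x (List.lookup points p))

        -- One column more than there are maps from rows to cells. As `R` depends on ψ alone,
        -- `points` and then `N` can be chosen after it.
        N : ℕ
        N = suc (cells ℕ.^ R)

        row-point∈points : ∀ (i : Fin R) {p} → p ∈ᴸ boundary (PFormula.formula (φ (toℕ i))) →
          root p (row-parameters (toℕ i)) ∈ᴸ points
        row-point∈points i p∈ = ∈-concat⁺′
          (∈-map⁺ (λ p → root p (row-parameters (toℕ i))) p∈) (∈-applyUpTo⁺ row-points (Fin.toℕ<n i))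

        abstract
          grid : ∀ i j → ∃[ x ] (Exactly φ R i x × Exactly (λ j → ψ ⟨ b j ⟩) N j x)
          grid i j = grid-point {φ} {m} {ψ} {b} i j (consistent i j) R N

        point : Fin R → Fin N → Carrier
        point i j = proj₁ (grid (toℕ i) (toℕ j))

        row-true : ∀ i j → Holds (φ (toℕ i)) (point i j ∷ [])
        row-true i j = literal-true (toℕ i ℕ.≟ toℕ i) ≡.refl (φ (toℕ i))
          (proj₁ (proj₂ (grid (toℕ i) (toℕ j))) (toℕ i) (Fin.toℕ<n i))

        row-false : ∀ {i i′} j → i′ ≢ i → ¬ Holds (φ (toℕ i′)) (point i j ∷ [])
        row-false {i} {i′} j i′≢i = literal-false (toℕ i′ ℕ.≟ toℕ i) (i′≢i ∘ Fin.toℕ-injective) (φ (toℕ i′))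
          (proj₁ (proj₂ (grid (toℕ i) (toℕ j))) (toℕ i′) (Fin.toℕ<n i′))

        column-true : ∀ i j → Holds (ψ ⟨ b (toℕ j) ⟩) (point i j ∷ [])
        column-true i j = literal-true (toℕ j ℕ.≟ toℕ j) ≡.refl (ψ ⟨ b (toℕ j) ⟩)
          (proj₂ (proj₂ (grid (toℕ i) (toℕ j))) (toℕ j) (Fin.toℕ<n j))

        column-false : ∀ i {j j′} → j′ ≢ j → ¬ Holds (ψ ⟨ b (toℕ j′) ⟩) (point i j ∷ [])
        column-false i {j} {j′} j′≢j =
          literal-false (toℕ j′ ℕ.≟ toℕ j) (j′≢j ∘ Fin.toℕ-injective) (ψ ⟨ b (toℕ j′) ⟩)
          (proj₂ (proj₂ (grid (toℕ i) (toℕ j))) (toℕ j′) (Fin.toℕ<n j′))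

        same-cell : ∀ {x y e} → cell x ≡ cell y → e ∈ᴸ points → sgn x e ≡ sgn y e
        same-cell {x} {y} x~y e∈ =
          ≡.subst (λ e → sgn x e ≡ sgn y e) (≡.sym (Any.lookup-index e∈)) (begin
            sgn x (List.lookup points ix)  ≡⟨ Fin.finToFun-funToFin (λ p → sgn x (List.lookup points p)) ix ⟨
            finToFun (cell x) ix           ≡⟨ ≡.cong (λ c → finToFun c ix) x~y ⟩
            finToFun (cell y) ix           ≡⟨ Fin.finToFun-funToFin (λ p → sgn y (List.lookup points p)) ix ⟩
            sgn y (List.lookup points ix)  ∎)
          where
          open ≡.≡-Reasoning
          ix : Fin (List.length points)
          ix = Any.index e∈

        -- In each row, ψ(x; b j₁) changes its truth value between the two points. As there are more
        -- rows than boundary points of ψ, two rows share a boundary point, hence a cell, although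
        -- different formulas φ i hold in them.
        module _ {j₁ j₂ : Fin N} (j₁≢j₂ : j₁ ≢ j₂)
                 (same-row-cell : ∀ i → cell (point i j₁) ≡ cell (point i j₂)) where

          ρ : Vec Carrier m
          ρ = Vec.map (λ c → c) (b (toℕ j₁))

          change : ∀ i → Any (λ p → sgn (point i j₁) (root p ρ) ≢ sgn (point i j₂) (root p ρ)) (boundary ψ)
          change i = separated ψ (column-true i j₁) (column-false i j₁≢j₂)

          boundary-point : Fin R → Carrier
          boundary-point i = root (List.lookup (boundary ψ) (Any.index (change i))) ρ

          -- Cells are convex, and the boundary point lies between two points of the same cell.
          boundary-point-cell : ∀ i {e} → e ∈ᴸ points → sgn (boundary-point i) e ≡ sgn (point i j₁) e
          boundary-point-cell i e∈ =
            sgn-between (same-cell {point i j₁} {point i j₂} (same-row-cell i) e∈)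
              (Any.lookup-index (change i))

          -- A shared boundary point would put the points of rows `i₁` and `i₂` in column `j₁` into
          -- one cell, but `φ` at `i₁` holds at only one of them, so a point of that row separates
          -- them.
          boundary-point-injective : ∀ {i₁ i₂} → i₁ ≢ i₂ → boundary-point i₁ ≢ boundary-point i₂
          boundary-point-injective {i₁} {i₂} i₁≢i₂ same =
            let p , p∈ , differ = find (separated (PFormula.formula (φ (toℕ i₁))) {point i₁ j₁} {point i₂ j₁}
                  {row-parameters (toℕ i₁)} (row-true i₁ j₁) (row-false {i₂} {i₁} j₁ i₁≢i₂))
                e∈ = row-point∈points i₁ p∈
            in differ (≡.trans (≡.sym (boundary-point-cell i₁ e∈))
                 (≡.trans (≡.cong (λ c → sgn c (root p (row-parameters (toℕ i₁)))) same)
                   (boundary-point-cell i₂ e∈)))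

          no-same-cells : Empty.⊥
          no-same-cells =
            -- The `R` rows pick among `R` - 1 boundary points.
            let i₁ , i₂ , i₁<i₂ , same = Fin.pigeonhole (ℕ.n<1+n _) (λ i → Any.index (change i)) in
            boundary-point-injective (Fin.<⇒≢ i₁<i₂) (≡.cong (λ k → root (List.lookup (boundary ψ) k) ρ) same)

        row-cells : Fin N → Fin R → Fin cells
        row-cells j i = cell (point i j)

        no-grid : Empty.⊥
        no-grid =
          let j₁ , j₂ , j₁<j₂ , same =
                Fin.pigeonhole (ℕ.n<1+n (cells ℕ.^ R)) (λ j → funToFin (row-cells j)) in
          no-same-cells (Fin.<⇒≢ j₁<j₂) λ i → ≡.trans (≡.sym (Fin.finToFun-funToFin (row-cells j₁) i))
            (≡.trans (≡.cong (λ c → finToFun c i) same) (Fin.finToFun-funToFin (row-cells j₂) i))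

      divisible⇒DpSmall : DpSmall 𝓤
      divisible⇒DpSmall (φ , m , ψ , b , consistent) = no-grid φ ψ b consistent

-- Transfer between `G` and the monster model.

commutativeS nontrivialS : Sentence L⟨+,<⟩
commutativeS = all (all (var #1 ⊞ var #0 ≐ var #0 ⊞ var #1))
nontrivialS = ex (ex (var #1 ≺ var #0))

theorem1p6 : (∀ {a : Level} → ExcludedMiddle a) →
    ∀ {g k u : Level} (G : OrderedGroup g) → Infinite G →
    {κ : Set k} (𝓤 : MonsterModel (Th (asStructure G)) κ u) →
    DpSmall 𝓤 ⇔ (Abelian G × Divisible G)
theorem1p6 em G infinite 𝓤 = mk⇔
  (λ small → G-abelian small , G-divisible small)
  (λ (G-comm , G-div) → divisible⇒DpSmall (models commutativeS G-comm) (U-divisible G-div) U-positive)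
  where
  open Classical em
  open Monster 𝓤
  open MonsterModel 𝓤 using (structure; models)
  open Structure structure using (Carrier; _≈_)

  G-isOG : IsOrderedGroup (asStructure G)
  G-isOG = asStructure-isOrderedGroup G

  module G = OrderedGroupProperties G-isOG
  module U = OrderedGroupProperties isOG

  G-abelian : DpSmall 𝓤 → Abelian G
  G-abelian small = reflects commutativeS (DpSmall⇒commutative small)

  -- Divisibility is a scheme with one sentence for each `m`, and each is transferred separately.
  G-divisible : DpSmall 𝓤 → Divisible G
  G-divisible small m x = divides⁻ G-isOG m #0 (x ∷ [])
    (reflects (all (divides m #0)) (λ x → divides⁺ isOG m #0 (x ∷ [])
      (DpSmall⇒divisible (DpSmall⇒commutative small) small m x)) x)

  U-divisible : Divisible G → ∀ k x → ∃[ y ] (suc k U.· y) ≈ x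
  U-divisible G-div k x = divides⁻ isOG (suc k) #0 (x ∷ [])
    (models (all (divides (suc k) #0)) (λ x → divides⁺ G-isOG (suc k) #0 (x ∷ []) (G-div (suc k) x)) x)

  G-nontrivial : ∃[ x ] ∃[ y ] x G.< y
  -- If no two elements were comparable, every element would equal zero and `G` would be in
  -- bijection with `Fin 1`.
  G-nontrivial = dne λ trivial → infinite (1 , record
    { to = λ _ → G.ε
    ; cong = λ _ → G.refl
    ; bijective = (λ { {zero} {zero} _ → ≡.refl }) , λ y → zero , λ _ → ε≈ trivial y
    })
    where
    ε≈ : ¬ (∃[ x ] ∃[ y ] x G.< y) → ∀ y → OrderedGroup._≈_ G G.ε y
    ε≈ trivial y with G.compare G.ε y
    ... | tri< ε<y _ _ = contradiction (_ , _ , ε<y) trivial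
    ... | tri≈ _ ε≈y _ = ε≈y
    ... | tri> _ _ y<ε = contradiction (_ , _ , y<ε) trivial

  U-positive : ∃[ x ] U.ε U.< x
  U-positive with ∃⁻ (models nontrivialS (∃⁺ (proj₁ G-nontrivial , ∃⁺ (proj₂ G-nontrivial))))
  ... | x , x<y with ∃⁻ x<y
  ...   | y , x<y = U.⊖ x U.⊕ y , U.<-respˡ-≈ (U.inverseˡ x) (U.<-translateˡ (U.⊖ x) x<y)
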